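{- Let $M$ be a multiline queue, $\alpha=\mathrm{type}(M)$ and $\beta=\mathrm{type}(\rho_N(M))$. For $i<j$, \[ \alpha_i<\alpha_j\implies \beta_i<\beta_j . \]
   Context: Fix $n$. For a partition $\lambda$ with $L=\lambda_1$, $n>\ell(\lambda)$, a multiline queue (MLQ) of shape $\lambda$ is a tuple $M=(B_1,\dots,B_L)$ of subsets of $[n]$ with $|B_r|=\lambda'_r$, pictured as an $L\times n$ array, rows $1..L$ bottom to top, columns $1..n$ left to right cyclically, ball at $(r,j)$ iff $j\in B_r$. FM labelling: for $r=L,\dots,2$: unlabelled balls of row $r$ get label $r$; then balls of row $r$ in order of decreasing label (left to right among equals) are each paired with the first not-yet-paired ball of row $r-1$ weakly to the right (cyclically), which receives the same label. Remaining balls of row 1 get label 1. $\mathrm{type}(M)$ is the length-$n$ sequence of row-1 labels (0 at empty sites). Bracketing w.r.t. $j$: in a word, $j\mapsto$ ")", $j+1\mapsto$ "(", other letters ignored; iteratively match a "(" with a ")" to its right when no unmatched parenthesis is between them. For a tuple $N$ of subsets of $[n]$, $cw(N)$ lists the row indices of the balls, columns left to right, each column top to bottom. $e^{\downarrow}_j(N)$ moves the ball of the leftmost unmatched $j+1$ of $cw(N)$ from row $j+1$ to row $j$ in the same column (identity if none); $e^{\downarrow\star}_j$ applies $e^{\downarrow}_j$ until it acts trivially. The collapsing map is $\rho_N(M)=e^{\downarrow\star}_{[L-1,1]}\cdots e^{\downarrow\star}_{[2,1]}e^{\downarrow\star}_{[1,1]}(M)$ with $e^{\downarrow\star}_{[b,1]}=e^{\downarrow\star}_1e^{\downarrow\star}_2\cdots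 e^{\downarrow\star}_b$ (operators applied right to left); $\rho_N(M)$ is again a multiline queue on $n$ columns. -}

module Defs where

open import Data.Nat using (ℕ; zero; suc; _+_; _∸_; _≤_; _<_; _≡ᵇ_)
open import Data.Bool using (Bool; true; false; if_then_else_; _∧_)
open import Data.List using (List; []; _∷_; map; concatMap; filter; foldl; drop; take; _++_; upTo; downFrom)
open import Data.Maybe using (Maybe; just; nothing)
open import Data.Vec using (Vec; []; _∷_; lookup; replicate; tabulate)
open import Data.Fin using (Fin; toℕ)
import Data.Fin as F
open import Data.Fin.Subset using (Subset; ∣_∣)
open import Data.Product using (_×_; _,_)
open import Function using (_∘_)
open import Relation.Nullary.Decidable using (⌊_⌋)
open import Data.Nat using (_≟_)

-- Conventions.
-- Columns are indexed 0..n-1 (column c here is column c+1 of the paper).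
-- Rows are indexed 1..L as in the paper; row r is stored at position r-1
-- of a  Vec (Subset n) L  (so the head of the vector is the bottom row 1).
-- A "tuple of subsets of [n]" of length L is  Vec (Subset n) L.

atℕ : ∀ {A : Set} {k} → A → Vec A k → ℕ → A
atℕ d []       _       = d
atℕ d (x ∷ xs) zero    = x
atℕ d (x ∷ xs) (suc i) = atℕ d xs i

setℕ : ∀ {A : Set} {k} → Vec A k → ℕ → A → Vec A k
setℕ []       _       a = []
setℕ (x ∷ xs) zero    a = a ∷ xs
setℕ (x ∷ xs) (suc i) a = x ∷ setℕ xs i a

-- ball at (row r, column c)   (r is 1-based, c is 0-based)
ball : ∀ {n L} → Vec (Subset n) L → ℕ → ℕ → Bool
ball {n} N r c = atℕ false (atℕ (replicate n false) N (r ∸ 1)) c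

setBall : ∀ {n L} → Vec (Subset n) L → ℕ → ℕ → Bool → Vec (Subset n) L
setBall {n} N r c b =
  setℕ N (r ∸ 1) (setℕ (atℕ (replicate n false) N (r ∸ 1)) c b)

rowOf : ∀ {n L} → Vec (Subset n) L → ℕ → Subset n
rowOf {n} N r = atℕ (replicate n false) N (r ∸ 1)

-- Multiline queues.
-- B is an MLQ of shape λ (λ a partition, L = λ₁, n > ℓ(λ)) with
-- |B_r| = λ'_r.  A sequence (λ'_1,…,λ'_L) is the conjugate of a partition
-- with λ₁ = L exactly when it is weakly decreasing and all entries ≥ 1,
-- and then ℓ(λ) = λ'_1.  Hence B is an MLQ (of some shape) iff:

record IsMLQ {n L : ℕ} (B : Vec (Subset n) L) : Set where
  field
    decreasing : ∀ (i j : Fin L) → i F.≤ j → ∣ lookup B j ∣ ≤ ∣ lookup B i ∣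
    nonempty   : ∀ (i : Fin L) → 1 ≤ ∣ lookup B i ∣
    lengthLt   : ∀ (i : Fin L) → ∣ lookup B i ∣ < n   -- ℓ(λ) = λ'_1 < n
    nPos       : 0 < n                               -- ℓ(λ) < n when λ = ∅

-- FM labelling.  A labelled row is a Vec ℕ n, 0 at empty sites.

columns : ℕ → List ℕ
columns n = upTo n

firstFree : ∀ {n} → Subset n → Vec ℕ n → ℕ → Maybe ℕ
firstFree {n} below assigned c = go (drop c (columns n) ++ take c (columns n))
  where
  go : List ℕ → Maybe ℕ
  go []       = nothing
  go (t ∷ ts) = if atℕ false below t ∧ (atℕ 0 assigned t ≡ᵇ 0) then just t else go ts

-- Given the labels of row k+1 (all balls labelled, labels in 1..L) and the
-- balls of row k, compute the labels of row k.  The balls of row k+1 are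
-- processed in order of decreasing label, left to right among equals.
stepLabel : ∀ {n} → ℕ → ℕ → Vec ℕ n → Subset n → Vec ℕ n
stepLabel {n} L k labs below = final (foldl pair (replicate n 0) order)
  where
  order : List ℕ
  order = concatMap (λ ℓ → filter (λ c → atℕ 0 labs c ≟ ℓ) (columns n))
                    (map suc (downFrom L))
  pair : Vec ℕ n → ℕ → Vec ℕ n
  pair assigned c with firstFree below assigned c
  ... | nothing = assigned
  ... | just t  = setℕ assigned t (atℕ 0 labs c)
  final : Vec ℕ n → Vec ℕ n
  final assigned = tabulate λ (j : Fin n) →
    if lookup below j
    then (if lookup assigned j ≡ᵇ 0 then k else lookup assigned j)
    else 0

type : ∀ {n L} → Vec (Subset n) L → Vec ℕ n
type {n} {zero}  B = replicate n 0
type {n} {suc m} B =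
  foldl (λ labs k → stepLabel (suc m) k labs (rowOf B k)) top (map suc (downFrom m))
  where
  top : Vec ℕ n
  top = Data.Vec.map (λ b → if b then suc m else 0) (rowOf B (suc m))

cw : ∀ {n L} → Vec (Subset n) L → List (ℕ × ℕ)
cw {n} {L} N = concatMap (λ c → concatMap (λ r → if ball N r c then (r , c) ∷ [] else [])
                                           (map suc (downFrom L)))
                         (columns n)

-- bracketing w.r.t. j: letter j+1 = "(", letter j = ")".  Scanning left to
-- right, the stack holds the columns of the currently unmatched "(" (most
-- recent first); a ")" is matched with the most recent unmatched "(".
unmatchedOpen : ℕ → List (ℕ × ℕ) → List ℕ
unmatchedOpen j = foldl step []
  where
  step : List ℕ → ℕ × ℕ → List ℕ
  step st (r , c) =
    if r ≡ᵇ suc j then c ∷ st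
    else (if r ≡ᵇ j then drop 1 st else st)

lastElem : List ℕ → Maybe ℕ
lastElem []           = nothing
lastElem (x ∷ [])     = just x
lastElem (x ∷ y ∷ xs) = lastElem (y ∷ xs)

e↓ : ∀ {n L} → ℕ → Vec (Subset n) L → Vec (Subset n) L
e↓ j N with lastElem (unmatchedOpen j (cw N))
... | nothing = N
... | just c  = setBall (setBall N (suc j) c false) j c true

iterateN : ∀ {A : Set} → ℕ → (A → A) → A → A
iterateN zero    f x = x
iterateN (suc k) f x = iterateN k f (f x)

-- e↓⋆_j : apply e↓_j until it acts trivially.  Every nontrivial application
-- removes a ball from row j+1, which has at most n balls, and once e↓_j
-- acts trivially it keeps doing so; hence n applications suffice.
e↓⋆ : ∀ {n L} → ℕ → Vec (Subset n) L → Vec (Subset n) L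
e↓⋆ {n} j = iterateN n (e↓ j)

e↓⋆range : ∀ {n L} → ℕ → Vec (Subset n) L → Vec (Subset n) L
e↓⋆range zero    N = N
e↓⋆range (suc b) N = e↓⋆range b (e↓⋆ (suc b) N)

ρN : ∀ {n L} → Vec (Subset n) L → Vec (Subset n) L
ρN {n} {L} M = foldl (λ N b → e↓⋆range b N) M (map suc (upTo (L ∸ 1)))

{-# OPTIONS --safe #-}

-- For a threshold k, the balls of row 1 with label ≥ k are the departures of a chain of
-- queues: the balls of row k are served by row k − 1, the departures by row k − 2, and so on
-- (each queue starting with as many customers as wrap around).  So α_i < α_j says that one
-- of these departure sets contains j but not i.
--
-- Replacing (bottom, top) = (b, a) by (departures, a ∪ unused services) does not change the
-- collapse of the two rows, and collapsing satisfies the braid relations, so ρ_N does not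
-- change either: we may assume that the separating set is row 1 itself, say X.  Moreover
-- ρ_N(X ∷ M) arises from X ∷ ρ_N(M) by collapsing rows 1 and 2, then 2 and 3, and so on.
-- Each of these steps enlarges the current row Y to some Y′ and leaves a part V of it matched,
-- with V ⊆ Y ⊆ Y′ and every element of Y ∖ V to the left of every element of Y′ ∖ Y.
-- Queues preserve this configuration, so a pair i < j separated by Y is separated by Y′ or
-- by V, and V is what the next row up contributes.  As nothing wraps around in ρ_N(M), these
-- sets are its label sets.
module Submission where

open import Defs
open import Data.Bool using (Bool; true; false; _∧_; not; if_then_else_)
open import Data.Empty using (⊥; ⊥-elim)
open import Data.Fin using (Fin; zero; suc)
import Data.Fin as F
open import Data.Fin.Subset using (Subset)
open import Data.List using (List; []; _∷_; [_]; _++_; foldl; filter; applyUpTo; upTo; downFrom; concatMap; map; drop; take)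
open import Data.List.Properties using (foldl-++; ++-identityʳ; ++-assoc; map-++; upTo-∷ʳ)
open import Data.Maybe using (Maybe; just; nothing; maybe′)
import Data.Maybe as Maybe
import Data.Maybe.Properties as Maybe
open import Data.Nat using (ℕ; zero; suc; _+_; _∸_; _⊓_; _≤_; _<_; z≤n; s≤s; _≤ᵇ_; _≡ᵇ_; _≤?_; _≟_)
open import Data.Nat.Properties using (+-suc; +-identityʳ; ≤-refl; ≤-reflexive; ≤-trans; ≤-pred; n≤1+n; m≤m+n; m+[n∸m]≡n; m≤n⇒m<n∨m≡n; n≤0⇒n≡0; 1+n≰n; <⇒≤; <⇒≱; <-irrefl; <-cmp; ≤∧≢⇒<; <-≤-connex; ⊓-zeroʳ)
open import Data.Product using (_×_; _,_; ∃; proj₁; proj₂)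
open import Data.Sum using (_⊎_; inj₁; inj₂; map₂)
open import Data.Vec using (Vec; []; _∷_; lookup; replicate; tabulate)
import Data.Vec as Vec
import Data.Vec.Properties as Vec
open import Function using (_∋_; _∘_; id)
open import Relation.Binary.Definitions using (tri<; tri≈; tri>)
open import Relation.Binary.PropositionalEquality using (_≡_; _≢_; refl; sym; trans; cong; cong₂; subst; subst₂)
open import Relation.Nullary using (¬_; yes; no; contradiction)
open import Relation.Nullary.Decidable using (dec-true; dec-false)
open import Relation.Unary using (Decidable)

-- Collapsing two adjacent rows

variable
  n L : ℕ

surplusStep : Bool → Bool → ℕ → ℕ
surplusStep true  true  k       = k
surplusStep true  false zero    = zero
surplusStep true  false (suc k) = k
surplusStep false true  k       = suc k
surplusStep false false k       = k

-- The last argument is the surplus of the columns to the right. A ball of the upper row falls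
-- exactly when the site below it is empty and this surplus is zero.
lowerBit upperBit : Bool → Bool → ℕ → Bool
lowerBit true  true  k       = true
lowerBit true  false zero    = true
lowerBit true  false (suc k) = false
lowerBit false b     k       = b
upperBit true  true  k       = true
upperBit true  false zero    = false
upperBit true  false (suc k) = true
upperBit false b     k       = false

-- surplus a b counts the unmatched ")" when a is the row of "(" and b the row of ")".
surplus : Subset n → Subset n → ℕ
surplus []       []       = 0
surplus (a ∷ as) (b ∷ bs) = surplusStep a b (surplus as bs)

lower upper : Subset n → Subset n → Subset n
lower []       []       = []
lower (a ∷ as) (b ∷ bs) = lowerBit a b (surplus as bs) ∷ lower as bs
upper []       []       = []
upper (a ∷ as) (b ∷ bs) = upperBit a b (surplus as bs) ∷ upper as bs

idem-step : ∀ a b {k k′} → k ≤ k′ →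
  let l = lowerBit a b k ; u = upperBit a b k in
  lowerBit u l k′ ≡ l × upperBit u l k′ ≡ u × surplusStep a b k ≤ surplusStep u l k′
idem-step true  true  k≤k′               = refl , refl , k≤k′
idem-step true  false {zero}  k≤k′       = refl , refl , z≤n
idem-step true  false {suc k} (s≤s k≤k′) = refl , refl , k≤k′
idem-step false true  k≤k′               = refl , refl , s≤s k≤k′
idem-step false false k≤k′               = refl , refl , k≤k′

-- A ball that stays up either rests over a ball or saw a positive surplus. Collapsing does not
-- lower the surplus, so it stays up again; hence the inequality carried along.
idem-rows : ∀ (a b : Subset n) →
  lower (upper a b) (lower a b) ≡ lower a b × upper (upper a b) (lower a b) ≡ upper a b ×
  surplus a b ≤ surplus (upper a b) (lower a b)
idem-rows []       []       = refl , refl , z≤n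
idem-rows (a ∷ as) (b ∷ bs) =
  let (p , q , r) = idem-rows as bs ; (p′ , q′ , r′) = idem-step a b r in
  cong₂ _∷_ p′ p , cong₂ _∷_ q′ q , r′

-- The surpluses met on the two sides of the braid relation are exchanged by
-- (k₁, k₂, k₃) ↦ (k₂ + k₃ − μ, μ, k₁ + k₂ − μ) with μ = min(k₁, k₃).
data BraidState : (k₁ k₂ k₃ l₁ l₂ l₃ : ℕ) → Set where
  right : ∀ {m y k l} t → k ≡ t + m → l ≡ t + y → BraidState m y k l m y
  left  : ∀ {m y k l} t → k ≡ t + m → l ≡ t + y → BraidState k y m y m l

-- One column of the two sides of the braid relation, with c above b above a. The left side
-- collapses the lower pair, the upper pair and the lower pair again; the right side starts with the
-- upper pair. The numbers are the surpluses to the right in these six collapses.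
BraidStep : (c b a : Bool) (k₁ k₂ k₃ l₁ l₂ l₃ : ℕ) → Set
BraidStep c b a k₁ k₂ k₃ l₁ l₂ l₃ =
  let a₁ = lowerBit b a k₁   ; b₁ = upperBit b a k₁
      b₂ = lowerBit c b₁ k₂  ; c₂ = upperBit c b₁ k₂
      β₁ = lowerBit c b l₁   ; γ₁ = upperBit c b l₁
      α₂ = lowerBit β₁ a l₂  ; β₂ = upperBit β₁ a l₂
  in lowerBit b₂ a₁ k₃ ≡ α₂ × upperBit b₂ a₁ k₃ ≡ lowerBit γ₁ β₂ l₃ × c₂ ≡ upperBit γ₁ β₂ l₃ ×
     BraidState (surplusStep b a k₁) (surplusStep c b₁ k₂) (surplusStep b₂ a₁ k₃)
                (surplusStep c b l₁) (surplusStep β₁ a l₂) (surplusStep γ₁ β₂ l₃)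

-- A finite check on one column. The order of k₁ and k₃ can be reversed only from t = 0; those cases
-- return the other constructor.
braid-right : ∀ c b a m y t → BraidStep c b a m y (t + m) (t + y) m y
braid-right false false false m       y       t       = refl , refl , refl , right t refl refl
braid-right false false true  m       y       t       = refl , refl , refl , right t (sym (+-suc t m)) refl
braid-right false true  false zero    y       t       = refl , refl , refl , right (suc t) refl refl
braid-right false true  false (suc m) y       zero    = refl , refl , refl , right 0 refl refl
braid-right false true  false (suc m) y       (suc t) = refl , refl , refl , right (suc t) (+-suc t m) (cong suc (sym (+-suc t y)))
braid-right false true  true  m       y       t       = refl , refl , refl , right t refl (sym (+-suc t y))
braid-right true  false false zero    zero    zero    = refl , refl , refl , right 0 refl refl
braid-right true  false false (suc m) zero    zero    = refl , refl , refl , left 1 refl refl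
braid-right true  false false m       zero    (suc t) = refl , refl , refl , right t refl refl
braid-right true  false false m       (suc y) zero    = refl , refl , refl , right 0 refl refl
braid-right true  false false m       (suc y) (suc t) = refl , refl , refl , right (suc t) refl (+-suc t y)
braid-right true  false true  m       zero    zero    = refl , refl , refl , left 1 refl refl
braid-right true  false true  m       zero    (suc t) = refl , refl , refl , right t (sym (+-suc t m)) refl
braid-right true  false true  m       (suc y) zero    = refl , refl , refl , right 0 refl refl
braid-right true  false true  m       (suc y) (suc t) = refl , refl , refl , right (suc t) (cong suc (sym (+-suc t m))) (+-suc t y)
braid-right true  true  false zero    zero    t       = refl , refl , refl , right t refl refl
braid-right true  true  false zero    (suc y) t       = refl , refl , refl , right (suc t) refl (+-suc t y)
braid-right true  true  false (suc m) y       zero    = refl , refl , refl , right 0 refl refl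
braid-right true  true  false (suc m) y       (suc t) = refl , refl , refl , right (suc t) (+-suc t m) refl
braid-right true  true  true  m       y       t       = refl , refl , refl , right t refl refl

braid-left : ∀ c b a m y t → BraidStep c b a (t + m) y m y m (t + y)
braid-left false false false m       y       t       = refl , refl , refl , left t refl refl
braid-left false false true  m       y       t       = refl , refl , refl , left t (sym (+-suc t m)) refl
braid-left false true  false zero    y       zero    = refl , refl , refl , right 1 refl refl
braid-left false true  false zero    y       (suc t) = refl , refl , refl , left t refl (sym (+-suc t y))
braid-left false true  false (suc m) y       zero    = refl , refl , refl , left 0 refl refl
braid-left false true  false (suc m) y       (suc t) = refl , refl , refl , left (suc t) (+-suc t m) (cong suc (sym (+-suc t y)))
braid-left false true  true  m       y       t       = refl , refl , refl , left t refl (sym (+-suc t y))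
braid-left true  false false zero    zero    t       = refl , refl , refl , left t refl refl
braid-left true  false false (suc m) zero    t       = refl , refl , refl , left (suc t) (+-suc t m) refl
braid-left true  false false m       (suc y) zero    = refl , refl , refl , left 0 refl refl
braid-left true  false false m       (suc y) (suc t) = refl , refl , refl , left (suc t) refl (+-suc t y)
braid-left true  false true  m       zero    t       = refl , refl , refl , left (suc t) refl refl
braid-left true  false true  m       (suc y) zero    = refl , refl , refl , left 0 refl refl
braid-left true  false true  m       (suc y) (suc t) = refl , refl , refl , left (suc t) (cong suc (sym (+-suc t m))) (+-suc t y)
braid-left true  true  false zero    zero    zero    = refl , refl , refl , left 0 refl refl
braid-left true  true  false zero    (suc y) zero    = refl , refl , refl , right 1 refl refl
braid-left true  true  false zero    y       (suc t) = refl , refl , refl , left t refl refl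
braid-left true  true  false (suc m) y       zero    = refl , refl , refl , left 0 refl refl
braid-left true  true  false (suc m) y       (suc t) = refl , refl , refl , left (suc t) (+-suc t m) refl
braid-left true  true  true  m       y       t       = refl , refl , refl , left t refl refl

braid-step : ∀ c b a {k₁ k₂ k₃ l₁ l₂ l₃} →
  BraidState k₁ k₂ k₃ l₁ l₂ l₃ → BraidStep c b a k₁ k₂ k₃ l₁ l₂ l₃
braid-step c b a (right {m} {y} t refl refl) = braid-right c b a m y t
braid-step c b a (left  {m} {y} t refl refl) = braid-left  c b a m y t

module _ {n} (a b c : Subset n) where
  private
    a₁ = lower b a  ; b₁ = upper b a
    b₂ = lower c b₁ ; c₂ = upper c b₁
    β₁ = lower c b  ; γ₁ = upper c b
    α₂ = lower β₁ a ; β₂ = upper β₁ a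

  BraidRows : Set
  BraidRows = lower b₂ a₁ ≡ α₂ × upper b₂ a₁ ≡ lower γ₁ β₂ × c₂ ≡ upper γ₁ β₂ ×
    BraidState (surplus b a) (surplus c b₁) (surplus b₂ a₁) (surplus c b) (surplus β₁ a) (surplus γ₁ β₂)

braid-rows : ∀ (a b c : Subset n) → BraidRows a b c
braid-rows []       []       []       = refl , refl , refl , right 0 refl refl
braid-rows (a ∷ as) (b ∷ bs) (c ∷ cs) =
  let (p , q , r , s) = braid-rows as bs cs ; (p′ , q′ , r′ , s′) = braid-step c b a s in
  cong₂ _∷_ p′ p , cong₂ _∷_ q′ q , cong₂ _∷_ r′ r , s′

-- collapse j is e↓⋆ (suc j).
collapse : ℕ → Vec (Subset n) L → Vec (Subset n) L
collapse zero    []          = []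
collapse zero    (b ∷ [])    = b ∷ []
collapse zero    (b ∷ a ∷ N) = lower a b ∷ upper a b ∷ N
collapse (suc j) []          = []
collapse (suc j) (b ∷ N)     = b ∷ collapse j N

collapse-idem : ∀ j (N : Vec (Subset n) L) → collapse j (collapse j N) ≡ collapse j N
collapse-idem zero    []          = refl
collapse-idem zero    (b ∷ [])    = refl
collapse-idem zero    (b ∷ a ∷ N) =
  let (p , q , _) = idem-rows a b in cong₂ (λ x y → x ∷ y ∷ N) p q
collapse-idem (suc j) []          = refl
collapse-idem (suc j) (b ∷ N)     = cong (b ∷_) (collapse-idem j N)

collapse-comm : ∀ {i j} → suc i < j → (N : Vec (Subset n) L) →
  collapse i (collapse j N) ≡ collapse j (collapse i N)
collapse-comm {i = zero}  {suc (suc j)} (s≤s (s≤s p)) []          = refl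
collapse-comm {i = zero}  {suc (suc j)} (s≤s (s≤s p)) (b ∷ [])    = refl
collapse-comm {i = zero}  {suc (suc j)} (s≤s (s≤s p)) (b ∷ a ∷ N) = refl
collapse-comm {i = suc i} {suc j}       (s≤s p)       []          = refl
collapse-comm {i = suc i} {suc j}       (s≤s p)       (b ∷ N)     = cong (b ∷_) (collapse-comm p N)

collapse-braid : ∀ j (N : Vec (Subset n) L) →
  collapse j (collapse (suc j) (collapse j N)) ≡ collapse (suc j) (collapse j (collapse (suc j) N))
collapse-braid zero    []              = refl
collapse-braid zero    (a ∷ [])        = refl
-- With two rows `collapse 1` is trivial, so the relation reduces to idempotence.
collapse-braid zero    (a ∷ b ∷ [])    = collapse-idem 0 (a ∷ b ∷ [])
collapse-braid zero    (a ∷ b ∷ c ∷ N) =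
  let (p , q , r , _) = braid-rows a b c in
  cong₂ _∷_ p (cong₂ _∷_ q (cong (_∷ N) r))
collapse-braid (suc j) []              = refl
collapse-braid (suc j) (a ∷ N)         = cong (a ∷_) (collapse-braid j N)

collapse-outside : ∀ {j} (N : Vec (Subset n) L) → L ≤ suc j → collapse j N ≡ N
collapse-outside {j = zero}  []          _       = refl
collapse-outside {j = zero}  (b ∷ [])    _       = refl
collapse-outside {j = zero}  (b ∷ a ∷ N) (s≤s ())
collapse-outside {j = suc j} []          _       = refl
collapse-outside {j = suc j} (b ∷ N)     (s≤s p) = cong (b ∷_) (collapse-outside N p)

-- Canonical form under collapsing

infix 4 _⇝_
data _⇝_ {n L} (N : Vec (Subset n) L) : Vec (Subset n) L → Set where
  stay : N ⇝ N
  then : ∀ {N′} → N ⇝ N′ → ∀ j → N ⇝ collapse j N′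

Stable : Vec (Subset n) L → Set
Stable N = ∀ j → collapse j N ≡ N

insertRow : Subset n → Vec (Subset n) L → Vec (Subset n) (suc L)
insertRow x []      = x ∷ []
insertRow x (h ∷ H) = lower h x ∷ insertRow (upper h x) H

-- Invariant under every collapse, and equal to the array itself when that is stable. Hence it gives
-- the stable array reached by any sequence of collapses.
canon : Vec (Subset n) L → Vec (Subset n) L
canon []      = []
canon (x ∷ N) = insertRow x (canon N)

-- By the braid relation the bottom rows of both sides agree. The pairs still to be inserted one row
-- higher again differ by a single collapse, so the induction continues.
insertRow-swap : ∀ (b a : Subset n) (H : Vec (Subset n) L) →
  insertRow (lower a b) (insertRow (upper a b) H) ≡ insertRow b (insertRow a H)
insertRow-swap b a []      = collapse-idem 0 (b ∷ a ∷ [])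
insertRow-swap b a (h ∷ H) =
  let (p , q , r , _) = braid-rows b a h in
  cong₂ _∷_ p (trans (cong₂ (λ x y → insertRow x (insertRow y H)) q r)
                     (insertRow-swap _ _ H))

canon-collapse : ∀ j (N : Vec (Subset n) L) → canon (collapse j N) ≡ canon N
canon-collapse zero    []          = refl
canon-collapse zero    (b ∷ [])    = refl
canon-collapse zero    (b ∷ a ∷ N) = insertRow-swap b a (canon N)
canon-collapse (suc j) []          = refl
canon-collapse (suc j) (b ∷ N)     = cong (insertRow b) (canon-collapse j N)

canon-⇝ : ∀ {N N′ : Vec (Subset n) L} → N ⇝ N′ → canon N′ ≡ canon N
canon-⇝ stay              = refl
canon-⇝ (then {N′} p j)   = trans (canon-collapse j N′) (canon-⇝ p)

tail-stable : ∀ {x} {N : Vec (Subset n) L} → Stable (x ∷ N) → Stable N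
tail-stable s j with s (suc j)
... | e = cong Vec.tail e

insertRow-stable : ∀ x (N : Vec (Subset n) L) → Stable (x ∷ N) → insertRow x N ≡ x ∷ N
insertRow-stable x []      s = refl
insertRow-stable x (h ∷ N) s =
  let e = s 0 in
  cong₂ _∷_ (cong Vec.head e)
    (trans (cong (λ y → insertRow y N) (cong (λ v → Vec.head (Vec.tail v)) e))
           (insertRow-stable h N (tail-stable s)))

canon-stable : ∀ (N : Vec (Subset n) L) → Stable N → canon N ≡ N
canon-stable []      s = refl
canon-stable (x ∷ N) s =
  trans (cong (insertRow x) (canon-stable N (tail-stable s))) (insertRow-stable x N s)

-- Sweeps and stability

sweep : ℕ → Vec (Subset n) L → Vec (Subset n) L
sweep zero    N = N
sweep (suc b) N = sweep b (collapse b N)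

sweeps : ℕ → Vec (Subset n) L → Vec (Subset n) L
sweeps zero    N = N
sweeps (suc m) N = sweep (suc m) (sweeps m N)

sweep-comm : ∀ b {j} → b < j → (N : Vec (Subset n) L) →
  sweep b (collapse j N) ≡ collapse j (sweep b N)
sweep-comm zero    b<j N = refl
sweep-comm (suc b) b<j N =
  trans (cong (sweep b) (collapse-comm b<j N)) (sweep-comm b (≤-trans (n≤1+n _) b<j) _)

-- The collapse commutes with the steps of the sweep above r + 1. It meets the steps r + 1 and r in
-- the braid relation, which raises its index, and then commutes with the remaining lower steps.
sweep-shift : ∀ b {r} → suc r < b → (N : Vec (Subset n) L) →
  sweep b (collapse r N) ≡ collapse (suc r) (sweep b N)
sweep-shift (suc b) {r} (s≤s r<b) N with m≤n⇒m<n∨m≡n r<b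
... | inj₁ r+1<b = trans (cong (sweep b) (sym (collapse-comm r+1<b N))) (sweep-shift b r+1<b _)
... | inj₂ refl  = trans (cong (sweep r) (collapse-braid r N)) (sweep-comm r ≤-refl _)

sweep-fixed : ∀ b (N : Vec (Subset n) L) → collapse 0 (sweep (suc b) N) ≡ sweep (suc b) N
sweep-fixed zero    N = collapse-idem 0 N
sweep-fixed (suc b) N = sweep-fixed b (collapse (suc b) N)

-- For r = 0, the last step of a sweep is `collapse 0`, which is idempotent. Otherwise `sweep-shift`
-- moves the collapse in front of the last sweep with its index lowered, where the induction
-- hypothesis absorbs it.
sweeps-fixed : ∀ m {r} → r < m → (N : Vec (Subset n) L) → collapse r (sweeps m N) ≡ sweeps m N
sweeps-fixed (suc m) {zero}  r<m       N = sweep-fixed m (sweeps m N)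
sweeps-fixed (suc m) {suc r} (s≤s r<m) N =
  trans (sym (sweep-shift (suc m) (s≤s r<m) (sweeps m N)))
        (cong (sweep (suc m)) (sweeps-fixed m r<m N))

sweep-⇝ : ∀ b {N N′ : Vec (Subset n) L} → N ⇝ N′ → N ⇝ sweep b N′
sweep-⇝ zero    p = p
sweep-⇝ (suc b) p = sweep-⇝ b (then p b)

sweeps-⇝ : ∀ m (N : Vec (Subset n) L) → N ⇝ sweeps m N
sweeps-⇝ zero    N = stay
sweeps-⇝ (suc m) N = sweep-⇝ (suc m) (sweeps-⇝ m N)

sweeps-stable : (N : Vec (Subset n) L) → Stable (sweeps (L ∸ 1) N)
sweeps-stable {L = zero}  [] zero    = refl
sweeps-stable {L = zero}  [] (suc j) = refl
sweeps-stable {L = suc m} N j with <-≤-connex j m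
... | inj₁ j<m = sweeps-fixed m j<m N
... | inj₂ m≤j = collapse-outside _ (s≤s m≤j)

sweeps≡canon : (N : Vec (Subset n) L) → sweeps (L ∸ 1) N ≡ canon N
sweeps≡canon {L = L} N =
  trans (sym (canon-stable _ (sweeps-stable N))) (canon-⇝ (sweeps-⇝ (L ∸ 1) N))

-- Queues

servedBit restBit : ℕ → Bool → Bool → Bool
servedBit q       a     false = false
servedBit q       true  true  = true
servedBit zero    false true  = false
servedBit (suc q) false true  = true
restBit q       true  b     = true
restBit q       false false = false
restBit zero    false true  = true
restBit (suc q) false true  = false

queueStep : ℕ → Bool → Bool → ℕ
queueStep q       true  true  = q
queueStep q       true  false = suc q
queueStep q       false false = q
queueStep zero    false true  = zero
queueStep (suc q) false true  = q

-- served q a b is the set of departures of a queue scanned from left to right with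
-- arrivals a, services b and initial length q; queued q a b is its final length.
served : ℕ → Subset n → Subset n → Subset n
served q []       []       = []
served q (a ∷ as) (b ∷ bs) = servedBit q a b ∷ served (queueStep q a b) as bs

queued : ℕ → Subset n → Subset n → ℕ
queued q []       []       = q
queued q (a ∷ as) (b ∷ bs) = queued (queueStep q a b) as bs

-- a together with the services of b that remain unused.
rest : ℕ → Subset n → Subset n → Subset n
rest q []       []       = []
rest q (a ∷ as) (b ∷ bs) = restBit q a b ∷ rest (queueStep q a b) as bs

exchange-step : ∀ q a b k {k′} → k′ ≡ queueStep q a b ⊓ k →
  let s = servedBit q a b ; r = restBit q a b in
  lowerBit r s k′ ≡ lowerBit a b k × upperBit r s k′ ≡ upperBit a b k ×
  surplusStep r s k′ ≡ q ⊓ surplusStep a b k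
exchange-step q       true  true  k       refl = refl , refl , refl
exchange-step q       true  false zero    refl = refl , refl , sym (⊓-zeroʳ q)
exchange-step q       true  false (suc k) refl = refl , refl , refl
exchange-step zero    false true  k       refl = refl , refl , refl
exchange-step (suc q) false true  k       refl = refl , refl , refl
exchange-step q       false false k       refl = refl , refl , refl

exchange : ∀ q (a b : Subset n) →
  lower (rest q a b) (served q a b) ≡ lower a b × upper (rest q a b) (served q a b) ≡ upper a b ×
  surplus (rest q a b) (served q a b) ≡ q ⊓ surplus a b
exchange q []       []       = refl , refl , sym (⊓-zeroʳ q)
exchange q (a ∷ as) (b ∷ bs) =
  let (l , u , s) = exchange (queueStep q a b) as bs ; (l′ , u′ , s′) = exchange-step q a b _ s in
  cong₂ _∷_ l′ l , cong₂ _∷_ u′ u , s′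

canon-exchange : ∀ q (b a : Subset n) (N : Vec (Subset n) L) →
  canon (served q a b ∷ rest q a b ∷ N) ≡ canon (b ∷ a ∷ N)
canon-exchange q b a N =
  let (l , u , _) = exchange q a b in
  trans (sym (canon-collapse 0 (served q a b ∷ rest q a b ∷ N)))
        (trans (cong₂ (λ x y → canon (x ∷ y ∷ N)) l u) (canon-collapse 0 (b ∷ a ∷ N)))

-- Triples of sets preserved by queues

infix 4 _⊑_
data _⊑_ : Bool → Bool → Set where
  f⊑b : ∀ {b} → false ⊑ b
  t⊑t : true ⊑ true

-- The columns to the right of the changeover in `Early`, where Y agrees with V and only X may be
-- larger.
data Late : (V Y X : Subset n) → Set where
  []  : Late [] [] []
  _∷_ : ∀ {v x} → v ⊑ x → {V Y X : Subset n} → Late V Y X → Late (v ∷ V) (v ∷ Y) (x ∷ X)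

-- V ⊆ Y ⊆ X, and every element of Y ∖ V lies to the left of every element of X ∖ Y.
data Early : (V Y X : Subset n) → Set where
  late : {V Y X : Subset n} → Late V Y X → Early V Y X
  _∷_  : ∀ {v y} → v ⊑ y → {V Y X : Subset n} → Early V Y X → Early (v ∷ V) (y ∷ Y) (y ∷ X)

⊑-refl : ∀ {b} → b ⊑ b
⊑-refl {false} = f⊑b
⊑-refl {true}  = t⊑t

⊑-true : ∀ {b} → b ⊑ true
⊑-true {false} = f⊑b
⊑-true {true}  = t⊑t

servedBit-mono : ∀ {q q′ a a′} b → q ≤ q′ → a ⊑ a′ → servedBit q a b ⊑ servedBit q′ a′ b
servedBit-mono false _       _               = f⊑b
servedBit-mono true  _       t⊑t             = t⊑t
servedBit-mono true  _       (f⊑b {true})    = ⊑-true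
servedBit-mono true  z≤n     (f⊑b {false})   = f⊑b
servedBit-mono true  (s≤s _) (f⊑b {false})   = t⊑t

queueStep-mono : ∀ {q q′ a a′} b → q ≤ q′ → a ⊑ a′ → queueStep q a b ≤ queueStep q′ a′ b
queueStep-mono false q≤q′       t⊑t           = s≤s q≤q′
queueStep-mono true  q≤q′       t⊑t           = q≤q′
queueStep-mono false q≤q′       (f⊑b {true})  = ≤-trans q≤q′ (n≤1+n _)
queueStep-mono false q≤q′       (f⊑b {false}) = q≤q′
queueStep-mono true  z≤n        (f⊑b {a′})    = z≤n
queueStep-mono true  (s≤s q≤q′) (f⊑b {true})  = ≤-trans q≤q′ (n≤1+n _)
queueStep-mono true  (s≤s q≤q′) (f⊑b {false}) = q≤q′

served-late : ∀ {q q′} {V Y X : Subset n} (x : Subset n) → q ≤ q′ → Late V Y X →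
  Late (served q V x) (served q Y x) (served q′ X x)
served-late []      p []      = []
served-late (b ∷ x) p (v ∷ l) = servedBit-mono b p v ∷ served-late x (queueStep-mono b p v) l

-- The first two queues have the same arrivals. As long as the second uses every service, so does
-- the third. A service that the second cannot use finds both of the first two queues empty, and
-- from there on they coincide.
served-switch : ∀ {p q r} {V Y X : Subset n} (x : Subset n) → p ≤ q → q ≤ r → Late V Y X →
  Early (served p V x) (served q Y x) (served r X x)
served-switch []          p q []            = late []
served-switch (false ∷ x) p q (_∷_ {v = v} v⊑ l) =
  f⊑b ∷ served-switch x (queueStep-mono false p (⊑-refl {v})) (queueStep-mono false q v⊑) l
served-switch (true ∷ x)  p q (t⊑t ∷ l)     = t⊑t ∷ served-switch x p q l
served-switch (true ∷ x)  z≤n z≤n (f⊑b ∷ l) = late (f⊑b ∷ served-late x z≤n l)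
served-switch (true ∷ x)  p (s≤s q) (f⊑b {true} ∷ l) =
  ⊑-true ∷ served-switch x (queueStep-mono true p (f⊑b {false})) (≤-trans q (n≤1+n _)) l
served-switch (true ∷ x)  p (s≤s q) (f⊑b {false} ∷ l) =
  ⊑-true ∷ served-switch x (queueStep-mono true p (f⊑b {false})) q l

served-early : ∀ {p q} {V Y X : Subset n} (x : Subset n) → p ≤ q → Early V Y X →
  Early (served p V x) (served q Y x) (served q X x)
served-early x       p (late l) = served-switch x p ≤-refl l
served-early (b ∷ x) p (v ∷ e)  = servedBit-mono b p v ∷ served-early x (queueStep-mono b p v) e

-- When the q customers already waiting use up the whole surplus, every service of b is used.
collapse-late : ∀ (a b : Subset n) →
  Late (served (surplus a b) (upper a b) (lower a b)) b (lower a b)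
collapse-late []           []           = []
collapse-late (true ∷ as)  (true ∷ bs)  = t⊑t ∷ collapse-late as bs
collapse-late (false ∷ as) (true ∷ bs)  = t⊑t ∷ collapse-late as bs
collapse-late (false ∷ as) (false ∷ bs) = f⊑b ∷ collapse-late as bs
collapse-late (true ∷ as)  (false ∷ bs) with surplus as bs | collapse-late as bs
... | zero  | l = f⊑b ∷ l
... | suc k | l = f⊑b ∷ l

-- Before the first falling ball, `b` and `lower a b` agree. That ball sees surplus zero, which
-- forces the queue to be empty there; its length then equals the surplus and `collapse-late` covers
-- the columns to the right.
collapse-early : ∀ {q} (a b : Subset n) → q ≤ surplus a b →
  Early (served q (upper a b) (lower a b)) b (lower a b)
collapse-early []           []           z≤n     = late []
collapse-early (true ∷ as)  (true ∷ bs)  p       = t⊑t ∷ collapse-early as bs p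
collapse-early (false ∷ as) (true ∷ bs)  z≤n     = f⊑b ∷ collapse-early as bs z≤n
collapse-early (false ∷ as) (true ∷ bs)  (s≤s p) = t⊑t ∷ collapse-early as bs p
collapse-early (false ∷ as) (false ∷ bs) p       = f⊑b ∷ collapse-early as bs p
collapse-early {q = q} (true ∷ as) (false ∷ bs) p
  with surplus as bs | collapse-late as bs | collapse-early {q = suc q} as bs
     | (q ≤ surplusStep true false (surplus as bs) ∋ p)
... | zero  | l | e | z≤n = late (f⊑b ∷ l)
... | suc k | l | e | p′  = f⊑b ∷ e (s≤s p′)

-- Every ball kept in the upper row is matched weakly to its right, and the surplus suffices for the
-- q customers already waiting. For q = 0 this says that nothing wraps around after a collapse.
queued-upper : ∀ {q} (a b : Subset n) → q ≤ surplus a b → queued q (upper a b) (lower a b) ≡ 0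
queued-upper []           []           z≤n     = refl
queued-upper (true ∷ as)  (true ∷ bs)  p       = queued-upper as bs p
queued-upper (false ∷ as) (true ∷ bs)  z≤n     = queued-upper as bs z≤n
queued-upper (false ∷ as) (true ∷ bs)  (s≤s p) = queued-upper as bs p
queued-upper (false ∷ as) (false ∷ bs) p       = queued-upper as bs p
queued-upper {q = q} (true ∷ as) (false ∷ bs) p
  with surplus as bs | queued-upper {q = 0} as bs | queued-upper {q = suc q} as bs
     | (q ≤ surplusStep true false (surplus as bs) ∋ p)
... | zero  | e | e′ | z≤n = e z≤n
... | suc k | e | e′ | p′  = e′ (s≤s p′)

-- Separated pairs

Separates : Subset n → Fin n → Fin n → Set
Separates X i j = lookup X i ≡ false × lookup X j ≡ true

late-≡ : ∀ {V Y X : Subset n} → Late V Y X → Y ≡ V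
late-≡ []      = refl
late-≡ (v ∷ l) = cong (_ ∷_) (late-≡ l)

late-mono : ∀ {V Y X : Subset n} → Late V Y X → ∀ {j} → lookup Y j ≡ true → lookup X j ≡ true
late-mono (t⊑t ∷ l) {zero}  e = refl
late-mono (v ∷ l)   {suc j} e = late-mono l e

-- If i lies in the early part, then X agrees with Y at i and contains Y. If i lies in the late
-- part, so does j because i < j, and there Y agrees with V.
early-split : ∀ {V Y X : Subset n} → Early V Y X → ∀ {i j} → i F.< j → Separates Y i j →
  Separates X i j ⊎ Separates V i j
early-split (late l) {i} {j} _ s = inj₂ (subst (λ Z → Separates Z i j) (late-≡ l) s)
early-split (f⊑b {false} ∷ e) {zero} {suc j} i<j (p , q) = inj₁ (refl , mono e q)
  where
  mono : ∀ {n} {V Y X : Subset n} → Early V Y X → ∀ {j} → lookup Y j ≡ true → lookup X j ≡ true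
  mono (late l) q = late-mono l q
  mono (v ∷ e) {zero}  q = q
  mono (v ∷ e) {suc j} q = mono e q
early-split (v ∷ e) {suc i} {suc j} (s≤s i<j) s = early-split e i<j s

serveDown : List (Subset n) → Subset n → Subset n
serveDown []       S = S
serveDown (x ∷ xs) S = serveDown xs (served 0 S x)

serveDown-early : ∀ (xs : List (Subset n)) {V Y X} → Early V Y X →
  Early (serveDown xs V) (serveDown xs Y) (serveDown xs X)
serveDown-early []       e = e
serveDown-early (x ∷ xs) e = serveDown-early xs (served-early x z≤n e)

-- The balls of row 1 carrying a label > k when no pairing wraps around.
level : Vec (Subset n) L → ℕ → Subset n
level []      k       = replicate _ false
level (x ∷ N) zero    = x
level (x ∷ N) (suc k) = served 0 (level N k) x

-- The list `xs` holds the rows already completed, the nearest first. The pair is separated either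
-- through the completed row `lower h Y` or through its matched part. The latter is by definition
-- the carried row `upper h Y` served by `lower h Y`, so the induction moves up one row.
separates-insertRow : ∀ (xs : List (Subset n)) Y (H : Vec (Subset n) L) {i j} → i F.< j →
  Separates (serveDown xs Y) i j →
  ∃ λ k → k < suc L × Separates (serveDown xs (level (insertRow Y H) k)) i j
separates-insertRow xs Y []      i<j s = 0 , s≤s z≤n , s
separates-insertRow xs Y (h ∷ H) i<j s
  with early-split (serveDown-early xs (collapse-early h Y z≤n)) i<j s
... | inj₁ s′ = 0 , s≤s z≤n , s′
... | inj₂ s′ with separates-insertRow (lower h Y ∷ xs) (upper h Y) H i<j s′
...   | k , k<L , s″ = suc k , s≤s k<L , s″

-- Pairings as departures of a queue

isFree : Subset n → Subset n → ℕ → Bool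
isFree x D s = atℕ false x s ∧ not (atℕ false D s)

record First (f : ℕ → Bool) (c t : ℕ) : Set where
  constructor first
  field
    bound   : c ≤ t
    holds   : f t ≡ true
    minimal : ∀ s → c ≤ s → s < t → f s ≡ false

NoneFrom : (ℕ → Bool) → ℕ → Set
NoneFrom f c = ∀ s → c ≤ s → f s ≡ false

true≢false : ∀ {b} → b ≡ true → b ≡ false → ⊥
true≢false refl ()

First-unique : ∀ {f c t t′} → First f c t → First f c t′ → t ≡ t′
First-unique {t = t} {t′} (first p h m) (first p′ h′ m′) with <-cmp t t′
... | tri< t<t′ _ _ = ⊥-elim (true≢false h (m′ t p t<t′))
... | tri≈ _ e _    = e
... | tri> _ _ t′<t = ⊥-elim (true≢false h′ (m t′ p′ t′<t))

First-none : ∀ {f c t} {A : Set} → First f c t → NoneFrom f c → A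
First-none (first p h _) none = ⊥-elim (true≢false h (none _ p))

-- The effect on a queue (D departures, final length k) of one more customer waiting at column c.
data Added (x : Subset n) (c : ℕ) (D : Subset n) (k : ℕ) : Subset n → ℕ → Set where
  serve : ∀ t → First (isFree x D) c t → Added x c D k (setℕ D t true) k
  queue : NoneFrom (isFree x D) c → Added x c D k D (suc k)

Added-∷ : ∀ {b d} {x D D′ : Subset n} {c k k′} →
  Added x c D k D′ k′ → Added (b ∷ x) (suc c) (d ∷ D) k (d ∷ D′) k′
Added-∷ (serve t (first p h m)) = serve (suc t) (first (s≤s p) h λ { (suc s) (s≤s q) (s≤s r) → m s q r })
Added-∷ (queue none)          = queue λ { (suc s) (s≤s q) → none s q }

Added-skip : ∀ {b d} {x D D′ : Subset n} {k k′} → b ∧ not d ≡ false →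
  Added x 0 D k D′ k′ → Added (b ∷ x) 0 (d ∷ D) k (d ∷ D′) k′
Added-skip e (serve t (first p h m)) =
  serve (suc t) (first z≤n h λ { zero _ _ → e ; (suc s) _ (s≤s r) → m s z≤n r })
Added-skip e (queue none) = queue λ { zero _ → e ; (suc s) _ → none s z≤n }

served-suc : ∀ q (S x : Subset n) →
  Added x 0 (served q S x) (queued q S x) (served (suc q) S x) (queued (suc q) S x)
served-suc q       []          []          = queue λ _ _ → refl
served-suc q       (true ∷ S)  (true ∷ x)  = Added-skip refl (served-suc q S x)
served-suc q       (true ∷ S)  (false ∷ x) = Added-skip refl (served-suc (suc q) S x)
served-suc q       (false ∷ S) (false ∷ x) = Added-skip refl (served-suc q S x)
served-suc (suc q) (false ∷ S) (true ∷ x)  = Added-skip refl (served-suc q S x)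
served-suc zero    (false ∷ S) (true ∷ x)  = serve 0 (first z≤n refl λ _ _ ())

served-set : ∀ q (S x : Subset n) c → c < n → atℕ false S c ≡ false →
  Added x c (served q S x) (queued q S x) (served q (setℕ S c true) x) (queued q (setℕ S c true) x)
served-set q       (s ∷ S)     (b ∷ x)     (suc c) (s≤s c<n) e = Added-∷ (served-set (queueStep q s b) S x c c<n e)
served-set q       (false ∷ S) (false ∷ x) zero    c<n e = Added-skip refl (served-suc q S x)
served-set (suc q) (false ∷ S) (true ∷ x)  zero    c<n e = Added-skip refl (served-suc q S x)
served-set zero    (false ∷ S) (true ∷ x)  zero    c<n e = serve 0 (first z≤n refl λ _ _ ())

-- D is the set of balls of row x paired with the balls S of the row above; load is the
-- number of pairings that wrap around, unless all balls of x are used up.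
record Pairing (S x D : Subset n) : Set where
  field
    load       : ℕ
    departures : D ≡ served load S x
    balanced   : queued load S x ≡ load ⊎ NoneFrom (isFree x D) 0
    wraps      : load ≡ 0 ⊎ 0 < queued 0 S x

data FirstFree (f : ℕ → Bool) (c : ℕ) : Maybe ℕ → Set where
  ahead   : ∀ {t} → First f c t → FirstFree f c (just t)
  wrapped : ∀ {t} → NoneFrom f c → First f 0 t → FirstFree f c (just t)
  full    : NoneFrom f 0 → FirstFree f c nothing

Added-≤ : ∀ {x D D′ : Subset n} {c k k′} → Added x c D k D′ k′ → k ≤ k′
Added-≤ (serve _ _) = ≤-refl
Added-≤ (queue _) = n≤1+n _

mark : Subset n → Maybe ℕ → Subset n
mark D = maybe′ (λ t → setℕ D t true) D

Pairing-empty : (x : Subset n) → Pairing (replicate n false) x (replicate n false)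
Pairing-empty x = record { load = 0 ; departures = sym (served-empty x) ; balanced = inj₁ (queued-empty x) ; wraps = inj₁ refl }
  where
  served-empty : ∀ {n} (x : Subset n) → served 0 (replicate n false) x ≡ replicate n false
  served-empty []          = refl
  served-empty (false ∷ x) = cong (false ∷_) (served-empty x)
  served-empty (true ∷ x)  = cong (false ∷_) (served-empty x)
  queued-empty : ∀ {n} (x : Subset n) → queued 0 (replicate n false) x ≡ 0
  queued-empty []          = refl
  queued-empty (false ∷ x) = queued-empty x
  queued-empty (true ∷ x)  = queued-empty x

-- A ball paired without wrapping is a customer served under the same load. A ball whose pairing
-- wraps is a customer still waiting at the right end; raising the load by one lets it start again
-- from the left. If no ball is free, the departures do not change.
Pairing-add : ∀ {S x D : Subset n} {c w} → Pairing S x D → c < n → atℕ false S c ≡ false →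
  FirstFree (isFree x D) c w → Pairing (setℕ S c true) x (mark D w)
Pairing-add {S = S} {x} {c = c} record { load = a ; departures = refl ; balanced = bal ; wraps = wr } c<n e w =
  go w _ _ refl refl (served-set a S x c c<n e)
  where
  S′ = setℕ S c true
  grow : queued 0 S x ≤ queued 0 S′ x
  grow = Added-≤ (served-set 0 S x c c<n e)
  wr′ : a ≡ 0 ⊎ 0 < queued 0 S′ x
  wr′ = map₂ (λ p → ≤-trans p grow) wr
  positive : a ≡ 0 ⊎ 0 < queued 0 S x → 0 < queued a S′ x → 0 < queued 0 S′ x
  positive (inj₁ refl) l = l
  positive (inj₂ l)    _ = ≤-trans l grow
  wrap : ∀ {D t} → queued a S x ≡ a ⊎ NoneFrom (isFree x D) 0 →
    D ≡ served a S′ x → suc (queued a S x) ≡ queued a S′ x → First (isFree x D) 0 t →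
    ∀ D″ k″ → D″ ≡ served (suc a) S′ x → k″ ≡ queued (suc a) S′ x →
    Added x 0 (served a S′ x) (queued a S′ x) D″ k″ → Pairing S′ x (setℕ D t true)
  wrap (inj₂ none) _ _ f = First-none f none
  wrap (inj₁ b) refl q f _ _ _ _ (queue none) = First-none f none
  wrap (inj₁ b) refl q f _ _ p′ q′ (serve _ f′) with First-unique f f′
  -- The final length has risen to a + 1 as well, so the new load is balanced.
  ... | refl = record
    { load = suc a ; departures = p′ ; balanced = inj₁ (trans (sym q′) (trans (sym q) (cong suc b)))
    ; wraps = inj₂ (positive wr (subst (0 <_) q (s≤s z≤n))) }
  go : ∀ {w} → FirstFree (isFree x (served a S x)) c w → ∀ D′ k′ → D′ ≡ served a S′ x → k′ ≡ queued a S′ x →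
    Added x c (served a S x) (queued a S x) D′ k′ → Pairing S′ x (mark (served a S x) w)
  go (ahead f) _ _ p q (queue none) = First-none f none
  go (ahead f) _ _ p q (serve _ f′) with First-unique f f′
  ... | refl = record { load = a ; departures = p ; balanced = inj₁ (trans (sym q) (bal′ bal)) ; wraps = wr′ }
    where
    bal′ : queued a S x ≡ a ⊎ NoneFrom (isFree x (served a S x)) 0 → queued a S x ≡ a
    bal′ (inj₁ b)    = b
    bal′ (inj₂ none) = First-none f (λ s _ → none s z≤n)
  go (wrapped none f) _ _ p q (serve _ f′) = First-none f′ none
  go (wrapped none f) _ _ p q (queue _) = wrap bal p q f _ _ refl refl (served-suc a S′ x)
  go (full none) _ _ p q (serve _ f′) = First-none f′ (λ s _ → none s z≤n)
  go (full none) _ _ p q (queue _) =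
    record { load = a ; departures = p ; balanced = inj₂ none ; wraps = wr′ }

Pairing-nowrap : ∀ {S x D : Subset n} → Pairing S x D → queued 0 S x ≡ 0 → D ≡ served 0 S x
Pairing-nowrap record { departures = d ; wraps = inj₁ refl } _ = d
Pairing-nowrap record { wraps = inj₂ p } e = ⊥-elim (<-irrefl (sym e) p)

-- The cyclic search for a free ball

scan : (ℕ → Bool) → List ℕ → Maybe ℕ
scan f []       = nothing
scan f (t ∷ ts) = if f t then just t else scan f ts

-- Identifies a search through its recursion equations alone, so that it applies to a local function
-- without a name.
scan-unique : ∀ {f} (g : List ℕ → Maybe ℕ) → g [] ≡ nothing →
  (∀ t ts → g (t ∷ ts) ≡ (if f t then just t else g ts)) → ∀ ts → g ts ≡ scan f ts
scan-unique     g p q []       = p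
scan-unique {f} g p q (t ∷ ts) with f t | q t ts
... | true  | e = e
... | false | e = trans e (scan-unique g p q ts)

unassigned : Subset n → Vec ℕ n → ℕ → Bool
unassigned x st s = atℕ false x s ∧ (atℕ 0 st s ≡ᵇ 0)

-- goOf is solved by unification to the local function of firstFree, which has no name outside.
mutual
  goOf : Subset n → Vec ℕ n → ℕ → List ℕ → Maybe ℕ
  goOf x st c ts = _

  firstFree≡scan : ∀ (x : Subset n) st c →
    firstFree x st c ≡ scan (unassigned x st) (drop c (upTo n) ++ take c (upTo n))
  firstFree≡scan {n} x st c with drop c (upTo n) ++ take c (upTo n)
  ... | ts = scan-unique (goOf x st c) refl (λ _ _ → refl) ts

drop-range : ∀ {A : Set} (f : ℕ → A) c m → drop c (applyUpTo f (c + m)) ≡ applyUpTo (λ i → f (c + i)) m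
drop-range f zero    m = refl
drop-range f (suc c) m = drop-range (f ∘ suc) c m

take-range : ∀ {A : Set} (f : ℕ → A) c m → take c (applyUpTo f (c + m)) ≡ applyUpTo f c
take-range f zero    m = refl
take-range f (suc c) m = cong (f 0 ∷_) (take-range (f ∘ suc) c m)

scan-range : ∀ f {c} {g : ℕ → ℕ} m ts → (∀ i → g i ≡ c + i) →
  (∃ λ t → scan f (applyUpTo g m ++ ts) ≡ just t × First f c t) ⊎
  (scan f (applyUpTo g m ++ ts) ≡ scan f ts × (∀ s → c ≤ s → s < c + m → f s ≡ false))
scan-range f {c} zero ts p = inj₂ (refl , λ s c≤s s<c → contradiction c≤s (<⇒≱ (subst (s <_) (+-identityʳ c) s<c)))
scan-range f {c} {g} (suc m) ts p rewrite trans (p 0) (+-identityʳ c) with f c in eq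
... | true  = inj₁ (c , refl , first ≤-refl eq (λ s c≤s s<c → contradiction c≤s (<⇒≱ s<c)))
... | false with scan-range f {suc c} {g ∘ suc} m ts (λ i → trans (p (suc i)) (+-suc c i))
...   | inj₁ (t , e , first b h l) = inj₁ (t , e , first (≤-trans (n≤1+n c) b) h below)
  where
  below : ∀ s → c ≤ s → s < t → f s ≡ false
  below s c≤s s<t with m≤n⇒m<n∨m≡n c≤s
  ... | inj₁ c<s  = l s c<s s<t
  ... | inj₂ refl = eq
...   | inj₂ (e , l) = inj₂ (e , below)
  where
  below : ∀ s → c ≤ s → s < c + suc m → f s ≡ false
  below s c≤s s<t with m≤n⇒m<n∨m≡n c≤s
  ... | inj₁ c<s  = l s c<s (subst (s <_) (+-suc c m) s<t)
  ... | inj₂ refl = eq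

scan-[] : ∀ f {g : ℕ → ℕ} m → (∀ i → g i ≡ i) →
  (∃ λ t → scan f (applyUpTo g m) ≡ just t × First f 0 t) ⊎
  (scan f (applyUpTo g m) ≡ nothing × (∀ s → 0 ≤ s → s < m → f s ≡ false))
scan-[] f {g} m p with scan-range f {0} {g} m [] p
... | r rewrite ++-identityʳ (applyUpTo g m) = r

atℕ-≥ : ∀ {A : Set} {d : A} (v : Vec A n) {s} → n ≤ s → atℕ d v s ≡ d
atℕ-≥ []      _       = refl
atℕ-≥ (a ∷ v) (s≤s p) = atℕ-≥ v p

columns-from : ∀ {c} → c < n → drop c (upTo n) ++ take c (upTo n) ≡ applyUpTo (c +_) (n ∸ c) ++ upTo c
columns-from {n} {c} c<n =
  trans (cong (λ m → drop c (upTo m) ++ take c (upTo m)) (sym (m+[n∸m]≡n (≤-trans (n≤1+n c) c<n))))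
        (cong₂ _++_ (drop-range id c (n ∸ c)) (take-range id c (n ∸ c)))

firstFree-spec : ∀ (x : Subset n) st {c} → c < n → FirstFree (unassigned x st) c (firstFree x st c)
firstFree-spec {n} x st {c} c<n
  rewrite firstFree≡scan x st c | columns-from c<n
  with scan-range (unassigned x st) {c} {c +_} (n ∸ c) (upTo c) (λ _ → refl)
... | inj₁ (t , e , f) rewrite e = ahead f
... | inj₂ (e , l) rewrite e = second (scan-[] (unassigned x st) c (λ _ → refl))
  where
  none : NoneFrom (unassigned x st) c
  none s c≤s with <-≤-connex s n
  ... | inj₁ s<n = l s c≤s (subst (s <_) (sym (m+[n∸m]≡n (≤-trans (n≤1+n c) c<n))) s<n)
  ... | inj₂ n≤s = cong (_∧ _) (atℕ-≥ x n≤s)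
  second : ∀ {w} →
    (∃ λ t → w ≡ just t × First (unassigned x st) 0 t) ⊎
    (w ≡ nothing × (∀ s → 0 ≤ s → s < c → unassigned x st s ≡ false)) →
    FirstFree (unassigned x st) c w
  second (inj₁ (t , refl , f)) = wrapped none f
  second (inj₂ (refl , l′)) = full all
    where
    all : NoneFrom (unassigned x st) 0
    all s _ with <-≤-connex s c
    ... | inj₁ s<c = l′ s z≤n s<c
    ... | inj₂ c≤s = none s c≤s

-- The label sets of the FM labelling

pairTo : Vec ℕ n → Subset n → Vec ℕ n → ℕ → Vec ℕ n
pairTo labs x st c = maybe′ (λ t → setℕ st t (atℕ 0 labs c)) st (firstFree x st c)

labelled : Vec ℕ n → ℕ → List ℕ
labelled {n} labs ℓ = filter (λ c → atℕ 0 labs c ≟ ℓ) (upTo n)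

pairAll : ℕ → Vec ℕ n → Subset n → Vec ℕ n → Vec ℕ n
pairAll m labs x st = foldl (pairTo labs x) st (concatMap (labelled labs) (map suc (downFrom m)))

finish : ℕ → Subset n → Vec ℕ n → Vec ℕ n
finish r x st = tabulate λ j →
  if lookup x j then (if lookup st j ≡ᵇ 0 then r else lookup st j) else 0

foldl-cong : ∀ {A B : Set} {g h : A → B → A} → (∀ a b → g a b ≡ h a b) →
  ∀ a bs → foldl g a bs ≡ foldl h a bs
foldl-cong         e a []       = refl
foldl-cong {h = h} e a (b ∷ bs) rewrite e a b = foldl-cong e (h a b) bs

-- The witness is left to unification: it is the local pairing function of `stepLabel`, thereby
-- available for comparison with `pairTo`.
pairOf : ∀ m r (labs : Vec ℕ n) x → ∃ λ g →
  stepLabel m r labs x ≡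
  finish r x (foldl g (replicate n 0) (concatMap (labelled labs) (map suc (downFrom m))))
pairOf m r labs x = _ , refl

pairOf≡pairTo : ∀ m r (labs : Vec ℕ n) x st c → proj₁ (pairOf m r labs x) st c ≡ pairTo labs x st c
pairOf≡pairTo m r labs x st c with firstFree x st c
... | nothing = refl
... | just t  = refl

stepLabel≡ : ∀ m r (labs : Vec ℕ n) x →
  stepLabel m r labs x ≡ finish r x (pairAll m labs x (replicate n 0))
stepLabel≡ m r labs x = trans (proj₂ (pairOf m r labs x))
  (cong (finish r x) (foldl-cong (pairOf≡pairTo m r labs x) _ (concatMap (labelled labs) (map suc (downFrom m)))))

atLeast : ℕ → Vec ℕ n → Subset n
atLeast k = Vec.map (k ≤ᵇ_)

≤ᵇ-true : ∀ {k v} → k ≤ v → (k ≤ᵇ v) ≡ true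
≤ᵇ-true {k} {v} = dec-true (k ≤? v)

≤ᵇ-false : ∀ {k v} → ¬ k ≤ v → (k ≤ᵇ v) ≡ false
≤ᵇ-false {k} {v} = dec-false (k ≤? v)

≤ᵇ-suc : ∀ {k v} → v ≢ k → (suc k ≤ᵇ v) ≡ (k ≤ᵇ v)
≤ᵇ-suc {k} {v} v≢k with k ≤? v
... | yes p = trans (≤ᵇ-true (≤∧≢⇒< p (v≢k ∘ sym))) (sym (≤ᵇ-true p))
... | no ¬p = trans (≤ᵇ-false (¬p ∘ <⇒≤)) (sym (≤ᵇ-false ¬p))

-- the balls labelled > ℓ, and those labelled ℓ in the first s columns.
upto : ℕ → ℕ → Vec ℕ n → Subset n
upto ℓ s       []       = []
upto ℓ zero    (v ∷ vs) = (suc ℓ ≤ᵇ v) ∷ upto ℓ zero vs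
upto ℓ (suc s) (v ∷ vs) = (ℓ ≤ᵇ v) ∷ upto ℓ s vs

upto-zero : ∀ ℓ (v : Vec ℕ n) → upto ℓ 0 v ≡ atLeast (suc ℓ) v
upto-zero ℓ []       = refl
upto-zero ℓ (v ∷ vs) = cong (_ ∷_) (upto-zero ℓ vs)

upto-all : ∀ ℓ (v : Vec ℕ n) → upto ℓ n v ≡ atLeast ℓ v
upto-all ℓ []       = refl
upto-all ℓ (v ∷ vs) = cong (_ ∷_) (upto-all ℓ vs)

upto-absent : ∀ ℓ s (v : Vec ℕ n) → s < n → atℕ 0 v s ≡ ℓ → atℕ false (upto ℓ s v) s ≡ false
upto-absent ℓ zero    (v ∷ vs) _       refl = ≤ᵇ-false {suc ℓ} {ℓ} 1+n≰n
upto-absent ℓ (suc s) (v ∷ vs) (s≤s p) e    = upto-absent ℓ s vs p e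

upto-set : ∀ ℓ s (v : Vec ℕ n) → s < n → atℕ 0 v s ≡ ℓ → upto ℓ (suc s) v ≡ setℕ (upto ℓ s v) s true
upto-set ℓ zero    (v ∷ vs) _       refl = cong (_∷ upto ℓ 0 vs) (≤ᵇ-true {ℓ} {ℓ} ≤-refl)
upto-set ℓ (suc s) (v ∷ vs) (s≤s p) e    = cong (_ ∷_) (upto-set ℓ s vs p e)

upto-skip : ∀ ℓ s (v : Vec ℕ n) → s < n → atℕ 0 v s ≢ ℓ → upto ℓ (suc s) v ≡ upto ℓ s v
upto-skip ℓ zero    (v ∷ vs) _       ne = cong (_∷ upto ℓ 0 vs) (sym (≤ᵇ-suc ne))
upto-skip ℓ (suc s) (v ∷ vs) (s≤s p) ne = cong (_ ∷_) (upto-skip ℓ s vs p ne)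

-- `Inv s` describes the state once all columns before s have been passed. Columns rejected by the
-- filter advance s too, so the final index is n whichever columns are kept.
fold-columns : ∀ {A : Set} {P : ℕ → Set} (P? : Decidable P) (h : A → ℕ → A) (Inv : ℕ → A → Set) →
  (∀ s st → s < n → P s → Inv s st → Inv (suc s) (h st s)) →
  (∀ s st → s < n → ¬ P s → Inv s st → Inv (suc s) st) →
  ∀ m {c g} → (∀ i → g i ≡ c + i) → c + m ≡ n → ∀ st → Inv c st →
  Inv n (foldl h st (filter P? (applyUpTo g m)))
fold-columns P? h Inv hit miss zero {c} p refl st i = subst (λ z → Inv z st) (sym (+-identityʳ c)) i
fold-columns {n = n} P? h Inv hit miss (suc m) {c} {g} p e st i
  rewrite trans (p 0) (+-identityʳ c) with P? c
... | yes Pc = fold-columns P? h Inv hit miss m (λ i → trans (p (suc i)) (+-suc c i))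
                 (trans (sym (+-suc c m)) e) _ (hit c st c<n Pc i)
  where c<n : c < n
        c<n = subst (c <_) e (subst (suc c ≤_) (sym (+-suc c m)) (s≤s (m≤m+n c m)))
... | no ¬Pc = fold-columns P? h Inv hit miss m (λ i → trans (p (suc i)) (+-suc c i))
                 (trans (sym (+-suc c m)) e) _ (miss c st c<n ¬Pc i)
  where c<n : c < n
        c<n = subst (c <_) e (subst (suc c ≤_) (sym (+-suc c m)) (s≤s (m≤m+n c m)))

fold-labelled : ∀ {A : Set} (labs : Vec ℕ n) ℓ (h : A → ℕ → A) (Inv : ℕ → A → Set) →
  (∀ s st → s < n → atℕ 0 labs s ≡ ℓ → Inv s st → Inv (suc s) (h st s)) →
  (∀ s st → s < n → atℕ 0 labs s ≢ ℓ → Inv s st → Inv (suc s) st) →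
  ∀ st → Inv 0 st → Inv n (foldl h st (labelled labs ℓ))
fold-labelled {n} labs ℓ h Inv hit miss = fold-columns (λ c → atℕ 0 labs c ≟ ℓ) h Inv hit miss n (λ _ → refl) refl

atℕ-map : ∀ {A B : Set} (f : A → B) {d} (v : Vec A n) s → atℕ (f d) (Vec.map f v) s ≡ f (atℕ d v s)
atℕ-map f []       s       = refl
atℕ-map f (a ∷ v)  zero    = refl
atℕ-map f (a ∷ v)  (suc s) = atℕ-map f v s

map-setℕ : ∀ {A B : Set} (f : A → B) (v : Vec A n) s a → Vec.map f (setℕ v s a) ≡ setℕ (Vec.map f v) s (f a)
map-setℕ f []       s       a = refl
map-setℕ f (x ∷ v)  zero    a = refl
map-setℕ f (x ∷ v)  (suc s) a = cong (_ ∷_) (map-setℕ f v s a)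

setℕ-same : ∀ {A : Set} {d : A} (v : Vec A n) s → setℕ v s (atℕ d v s) ≡ v
setℕ-same []      s       = refl
setℕ-same (x ∷ v) zero    = refl
setℕ-same (x ∷ v) (suc s) = cong (x ∷_) (setℕ-same v s)

FirstFree-cong : ∀ {f g : ℕ → Bool} {c w} → (∀ s → f s ≡ g s) → FirstFree f c w → FirstFree g c w
FirstFree-cong {f} {g} e w = go w
  where
  first′ : ∀ {c t} → First f c t → First g c t
  first′ (first b h m) = first b (trans (sym (e _)) h) (λ s p q → trans (sym (e s)) (m s p q))
  none′ : ∀ {c} → NoneFrom f c → NoneFrom g c
  none′ l s p = trans (sym (e s)) (l s p)
  go : ∀ {w} → FirstFree f _ w → FirstFree g _ w
  go (ahead p)     = ahead (first′ p)
  go (wrapped l p) = wrapped (none′ l) (first′ p)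
  go (full l)      = full (none′ l)

AllAt : (ℕ → Set) → Vec ℕ n → Set
AllAt P v = ∀ s → P (atℕ 0 v s)

setℕ-AllAt : ∀ {P} (v : Vec ℕ n) t {a} → P a → AllAt P v → AllAt P (setℕ v t a)
setℕ-AllAt []      t       p q s       = q s
setℕ-AllAt (x ∷ v) zero    p q zero    = p
setℕ-AllAt (x ∷ v) zero    p q (suc s) = q (suc s)
setℕ-AllAt (x ∷ v) (suc t) p q zero    = q 0
setℕ-AllAt {P = P} (x ∷ v) (suc t) p q (suc s) = setℕ-AllAt {P = P} v t p (λ s → q (suc s)) s

ZeroOr≥ : ℕ → ℕ → Set
ZeroOr≥ k v = v ≡ 0 ⊎ k ≤ v

module _ (labs : Vec ℕ n) (x : Subset n) where

  pairTo-AllAt : ∀ {P} st c → P (atℕ 0 labs c) → AllAt P st → AllAt P (pairTo labs x st c)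
  pairTo-AllAt {P} st c p q with firstFree x st c
  ... | nothing = q
  ... | just t  = setℕ-AllAt {P = P} st t p q

  pairAll-AllAt : ∀ {P} → AllAt P labs → ∀ cs st → AllAt P st → AllAt P (foldl (pairTo labs x) st cs)
  pairAll-AllAt p []       st q = q
  pairAll-AllAt {P} p (c ∷ cs) st q = pairAll-AllAt {P} p cs _ (pairTo-AllAt {P} st c (p c) q)

  module _ (k : ℕ) where
    private K = suc k

    free≡ : ∀ {st} → AllAt (ZeroOr≥ K) st → ∀ s → unassigned x st s ≡ isFree x (atLeast K st) s
    free≡ {st} z s rewrite atℕ-map (K ≤ᵇ_) {0} st s with z s
    ... | inj₁ e rewrite e = refl
    ... | inj₂ p with atℕ 0 st s
    ...   | suc v rewrite ≤ᵇ-true p = refl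

    atLeast-pairTo : ∀ st c → K ≤ atℕ 0 labs c →
      atLeast K (pairTo labs x st c) ≡ mark (atLeast K st) (firstFree x st c)
    atLeast-pairTo st c p with firstFree x st c
    ... | nothing = refl
    ... | just t  = trans (map-setℕ (K ≤ᵇ_) st t _) (cong (setℕ _ t) (≤ᵇ-true p))

    -- The invariant while labels at least K are processed. No smaller label has been assigned yet,
    -- so the balls free for the labelling are exactly those outside the set of threshold K.
    High : Subset n → Vec ℕ n → Set
    High S st = Pairing S x (atLeast K st) × AllAt (ZeroOr≥ K) st

    High-add : ∀ {S st c} → c < n → K ≤ atℕ 0 labs c → atℕ false S c ≡ false → High S st →
      High (setℕ S c true) (pairTo labs x st c)
    High-add {S} {st} {c} c<n K≤ e (p , z) =
      subst (Pairing _ x) (sym (atLeast-pairTo st c K≤))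
        (Pairing-add p c<n e (FirstFree-cong (free≡ {st} z) (firstFree-spec x st c<n))) ,
      pairTo-AllAt {ZeroOr≥ K} st c (inj₂ K≤) z

    High-label : ∀ {ℓ st} → K ≤ ℓ → High (atLeast (suc ℓ) labs) st →
      High (atLeast ℓ labs) (foldl (pairTo labs x) st (labelled labs ℓ))
    High-label {ℓ} {st} K≤ℓ h =
      subst (λ S → High S (foldl (pairTo labs x) st (labelled labs ℓ))) (upto-all ℓ labs)
        (fold-labelled labs ℓ (pairTo labs x) (λ s → High (upto ℓ s labs))
          (λ s st s<n e h → subst (λ S → High S _) (sym (upto-set ℓ s labs s<n e))
            (High-add s<n (subst (K ≤_) (sym e) K≤ℓ) (upto-absent ℓ s labs s<n e) h))
          (λ s st s<n ne h → subst (λ S → High S st) (sym (upto-skip ℓ s labs s<n ne)) h)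
          st (subst (λ S → High S st) (sym (upto-zero ℓ labs)) h))

    -- The site found carried 0 and the new label is below K, so it is outside the threshold set
    -- both before and after.
    low-pairTo : ∀ st {c} → c < n → atℕ 0 labs c < K → atLeast K (pairTo labs x st c) ≡ atLeast K st
    low-pairTo st {c} c<n l with firstFree x st c | firstFree-spec x st c<n
    ... | nothing | _ = refl
    ... | just t  | w =
      trans (map-setℕ (K ≤ᵇ_) st t _)
        (trans (cong (setℕ _ t) (trans (≤ᵇ-false (<⇒≱ l)) (sym (trans (atℕ-map (K ≤ᵇ_) {0} st t) (cong (K ≤ᵇ_) (unlabelled w))))))
               (setℕ-same (atLeast K st) t))
      where
      zero-at : ∀ b v → b ∧ (v ≡ᵇ 0) ≡ true → v ≡ 0
      zero-at true zero refl = refl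
      unlabelled : FirstFree (unassigned x st) c (just t) → atℕ 0 st t ≡ 0
      unlabelled (ahead f)     = zero-at (atℕ false x t) _ (First.holds f)
      unlabelled (wrapped _ f) = zero-at (atℕ false x t) _ (First.holds f)

    low-labels : ∀ m st → m < K → atLeast K (pairAll m labs x st) ≡ atLeast K st
    low-labels zero    st l = refl
    low-labels (suc m) st l
      rewrite foldl-++ (pairTo labs x) st (labelled labs (suc m)) (concatMap (labelled labs) (map suc (downFrom m))) =
      trans (low-labels m _ (≤-trans (n≤1+n _) l))
        (fold-labelled labs (suc m) (pairTo labs x) (λ _ st′ → atLeast K st′ ≡ atLeast K st)
          (λ s st′ s<n e i → trans (low-pairTo st′ s<n (subst (_< K) (sym e) l)) i)
          (λ _ _ _ _ i → i) st refl)

    -- Labels are processed in decreasing order. Those at least K preserve `High`; the later ones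
    -- leave the set of threshold K alone.
    pairAll-Pairing : ∀ m st → K ≤ suc m → High (atLeast (suc m) labs) st →
      Pairing (atLeast K labs) x (atLeast K (pairAll m labs x st))
    pairAll-Pairing m st K≤ h with m≤n⇒m<n∨m≡n K≤
    ... | inj₂ refl = subst (Pairing _ x) (sym (low-labels m st ≤-refl)) (proj₁ h)
    pairAll-Pairing (suc m) st _ h | inj₁ (s≤s K≤)
      rewrite foldl-++ (pairTo labs x) st (labelled labs (suc m)) (concatMap (labelled labs) (map suc (downFrom m))) =
      pairAll-Pairing m _ K≤ (High-label K≤ h)

lookup-ext : ∀ {A : Set} {u v : Vec A n} → (∀ j → lookup u j ≡ lookup v j) → u ≡ v
lookup-ext {u = u} {v} e =
  trans (sym (Vec.tabulate∘lookup u)) (trans (Vec.tabulate-cong e) (Vec.tabulate∘lookup v))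

lookup-AllAt : ∀ {P} (v : Vec ℕ n) → P 0 → (∀ j → P (lookup v j)) → AllAt P v
lookup-AllAt []      p q s       = p
lookup-AllAt (a ∷ v) p q zero    = q zero
lookup-AllAt {P = P} (a ∷ v) p q (suc s) = lookup-AllAt {P = P} v p (λ j → q (suc j)) s

AllAt-lookup : ∀ {P} (v : Vec ℕ n) → AllAt P v → ∀ j → P (lookup v j)
AllAt-lookup (a ∷ v) p zero    = p 0
AllAt-lookup {P = P} (a ∷ v) p (suc j) = AllAt-lookup {P = P} v (λ s → p (suc s)) j

atLeast-none : ∀ k {v : Vec ℕ n} → AllAt (_≤ k) v → atLeast (suc k) v ≡ replicate n false
atLeast-none k {v} p = lookup-ext λ j →
  trans (Vec.lookup-map j (suc k ≤ᵇ_) v)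
    (trans (≤ᵇ-false λ l → <⇒≱ l (AllAt-lookup {P = _≤ k} v p j)) (sym (Vec.lookup-replicate j false)))

-- `Late D D x` serves as the inclusion of D in x.
served-⊑ : ∀ q (S x : Subset n) → Late (served q S x) (served q S x) x
served-⊑ q []      []          = []
served-⊑ q (s ∷ S) (false ∷ x) = f⊑b ∷ served-⊑ _ S x
served-⊑ q (s ∷ S) (true ∷ x)  = ⊑-true ∷ served-⊑ _ S x

module _ (r : ℕ) (x : Subset n) (st : Vec ℕ n) where

  finishAt : Bool → ℕ → ℕ
  finishAt b v = if b then (if v ≡ᵇ 0 then r else v) else 0

  lookup-finish : ∀ j → lookup (finish r x st) j ≡ finishAt (lookup x j) (lookup st j)
  lookup-finish j = Vec.lookup∘tabulate _ j

  lookup-atLeast-finish : ∀ k j →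
    lookup (atLeast k (finish r x st)) j ≡ (k ≤ᵇ finishAt (lookup x j) (lookup st j))
  lookup-atLeast-finish k j = trans (Vec.lookup-map j (k ≤ᵇ_) (finish r x st)) (cong (k ≤ᵇ_) (lookup-finish j))

  -- Unpaired balls receive the label r, which stays below the threshold k + 1, and the inclusion in
  -- x ensures that no label reaching the threshold is erased.
  atLeast-finish : ∀ {k} → r ≤ k → Late (atLeast (suc k) st) (atLeast (suc k) st) x →
    atLeast (suc k) (finish r x st) ≡ atLeast (suc k) st
  atLeast-finish {k} r≤k sub = lookup-ext λ j →
    trans (lookup-atLeast-finish (suc k) j)
      (trans (at (lookup x j) (lookup st j) (λ e → late-mono sub (trans (Vec.lookup-map j (suc k ≤ᵇ_) st) e)))
             (sym (Vec.lookup-map j (suc k ≤ᵇ_) st)))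
    where
    at : ∀ b v → ((suc k ≤ᵇ v) ≡ true → b ≡ true) → (suc k ≤ᵇ finishAt b v) ≡ (suc k ≤ᵇ v)
    at true  zero    _ = ≤ᵇ-false (λ l → <⇒≱ l r≤k)
    at true  (suc v) _ = refl
    at false v       h with suc k ≤ᵇ v | h
    ... | false | _ = refl
    ... | true  | h′ = h′ refl

  finish-row : AllAt (ZeroOr≥ r) st → 0 < r → atLeast r (finish r x st) ≡ x
  finish-row z 0<r = lookup-ext λ j →
    trans (lookup-atLeast-finish r j) (at (lookup x j) (lookup st j) (AllAt-lookup {P = ZeroOr≥ r} st z j))
    where
    at : ∀ b v → ZeroOr≥ r v → (r ≤ᵇ finishAt b v) ≡ b
    at false v       _        = ≤ᵇ-false (<⇒≱ 0<r)
    at true  zero    _        = ≤ᵇ-true {r} ≤-refl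
    at true  (suc v) (inj₂ p) = ≤ᵇ-true p

  finish-AllAt : ∀ {P} → P 0 → P r → AllAt P st → AllAt P (finish r x st)
  finish-AllAt {P} p₀ pᵣ p = lookup-AllAt {P = P} (finish r x st) p₀ λ j →
    subst P (sym (lookup-finish j)) (at (lookup x j) (lookup st j) (AllAt-lookup {P = P} st p j))
    where
    at : ∀ b v → P v → P (finishAt b v)
    at false v       _ = p₀
    at true  zero    _ = pᵣ
    at true  (suc v) q = q

replicate-AllAt : ∀ {P} n → P 0 → AllAt P (replicate n 0)
replicate-AllAt zero    p s       = p
replicate-AllAt (suc n) p zero    = p
replicate-AllAt {P} (suc n) p (suc s) = replicate-AllAt {P} n p s

module _ (m r : ℕ) (labs : Vec ℕ n) (x : Subset n) where
  private st = pairAll m labs x (replicate n 0)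

  stepLabel-AllAt : ∀ {P} → P 0 → P r → AllAt P labs → AllAt P (stepLabel m r labs x)
  stepLabel-AllAt {P} p₀ pᵣ p = subst (AllAt P) (sym (stepLabel≡ m r labs x))
    (finish-AllAt r x st {P} p₀ pᵣ
      (pairAll-AllAt labs x {P} p (concatMap (labelled labs) (map suc (downFrom m))) _ (replicate-AllAt {P} n p₀)))

  stepLabel-row : AllAt (ZeroOr≥ r) labs → 0 < r → atLeast r (stepLabel m r labs x) ≡ x
  stepLabel-row z 0<r = trans (cong (atLeast r) (stepLabel≡ m r labs x))
    (finish-row r x st
      (pairAll-AllAt labs x {ZeroOr≥ r} z (concatMap (labelled labs) (map suc (downFrom m))) _
        (replicate-AllAt {ZeroOr≥ r} n (inj₁ refl))) 0<r)

  stepLabel-Pairing : ∀ {k} → AllAt (_≤ m) labs → r ≤ k → k ≤ m →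
    Pairing (atLeast (suc k) labs) x (atLeast (suc k) (stepLabel m r labs x))
  stepLabel-Pairing {k} l r≤k k≤m rewrite stepLabel≡ m r labs x =
    subst (Pairing _ x) (sym (atLeast-finish r x st r≤k sub)) paired
    where
    start : High labs x k (atLeast (suc m) labs) (replicate n 0)
    -- No label exceeds m, so before label m is processed the set of arrivals is empty.
    start = subst₂ (λ S D → Pairing S x D) (sym (atLeast-none m l))
              (sym (Vec.map-replicate (suc k ≤ᵇ_) 0 n)) (Pairing-empty x) ,
            replicate-AllAt {ZeroOr≥ (suc k)} n (inj₁ refl)
    paired : Pairing (atLeast (suc k) labs) x (atLeast (suc k) st)
    paired = pairAll-Pairing labs x k m (replicate n 0) (s≤s k≤m) start
    sub : Late (atLeast (suc k) st) (atLeast (suc k) st) x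
    sub = subst (λ D → Late D D x) (sym (Pairing.departures paired)) (served-⊑ _ (atLeast (suc k) labs) x)

-- Label sets as iterated departures

rowAt : Vec (Subset n) L → ℕ → Subset n
rowAt {n} B r = atℕ (replicate n false) B r

-- Level B r l C: C is the set of balls of row r + 1 whose label exceeds r + l.
data Level {n L} (B : Vec (Subset n) L) : (r l : ℕ) → Subset n → Set where
  base : ∀ {r} → Level B r 0 (rowAt B r)
  step : ∀ {r l C D} → Level B (suc r) l C → Pairing C (rowAt B r) D → Level B r (suc l) D

record Labelled (B : Vec (Subset n) L) (p : ℕ) (labs : Vec ℕ n) : Set where
  field
    levels : ∀ l → p + l < L → Level B p l (atLeast (suc (p + l)) labs)
    above  : AllAt (ZeroOr≥ (suc p)) labs
    below  : AllAt (_≤ L) labs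
open Labelled

Labelled-step : ∀ {B : Vec (Subset n) L} {p labs} → suc p ≤ L → Labelled B (suc p) labs →
  Labelled B p (stepLabel L (suc p) labs (rowAt B p))
Labelled-step {L = L} {B} {p} {labs} p<L lab = record
  { levels = levels′
  ; above  = stepLabel-AllAt L (suc p) labs (rowAt B p) {ZeroOr≥ (suc p)} (inj₁ refl) (inj₂ ≤-refl) above′
  ; below  = stepLabel-AllAt L (suc p) labs (rowAt B p) {_≤ L} z≤n p<L (below lab) }
  where
  above′ : AllAt (ZeroOr≥ (suc p)) labs
  above′ s = map₂ (≤-trans (n≤1+n _)) (above lab s)
  levels′ : ∀ l → p + l < L → Level B p l (atLeast (suc (p + l)) (stepLabel L (suc p) labs (rowAt B p)))
  -- Every ball of the row has label at least p + 1; a larger threshold counts only balls paired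
  -- with the row above.
  levels′ zero _ rewrite +-identityʳ p =
    subst (Level B p 0) (sym (stepLabel-row L (suc p) labs (rowAt B p) above′ (s≤s z≤n))) base
  levels′ (suc l) q rewrite +-suc p l =
    step (levels lab l q) (stepLabel-Pairing L (suc p) labs (rowAt B p) (below lab) (s≤s (m≤m+n p l)) (<⇒≤ q))

Labelled-fold : ∀ {B : Vec (Subset n) L} p {labs} → p ≤ L → Labelled B p labs →
  Labelled B 0 (foldl (λ labs k → stepLabel L k labs (rowOf B k)) labs (map suc (downFrom p)))
Labelled-fold zero    p≤L lab = lab
Labelled-fold (suc p) p≤L lab = Labelled-fold p (≤-trans (n≤1+n p) p≤L) (Labelled-step p≤L lab)

Labelled-top : ∀ {m} (B : Vec (Subset n) (suc m)) →
  Labelled B m (Vec.map (λ b → if b then suc m else 0) (rowAt B m))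
Labelled-top {n} {m} B = record { levels = levels′ ; above = above′ ; below = below′ }
  where
  val : Bool → ℕ
  val b = if b then suc m else 0
  row≡ : atLeast (suc m) (Vec.map val (rowAt B m)) ≡ rowAt B m
  row≡ = trans (sym (Vec.map-∘ (suc m ≤ᵇ_) val (rowAt B m)))
               (trans (Vec.map-cong (λ { true → ≤ᵇ-true {suc m} ≤-refl ; false → refl }) (rowAt B m)) (Vec.map-id _))
  levels′ : ∀ l → m + l < suc m → Level B m l (atLeast (suc (m + l)) (Vec.map val (rowAt B m)))
  levels′ zero    _ rewrite +-identityʳ m = subst (Level B m 0) (sym row≡) base
  levels′ (suc l) q rewrite +-suc m l = contradiction (m≤m+n m l) (<⇒≱ (≤-pred q))
  above′ : AllAt (ZeroOr≥ (suc m)) (Vec.map val (rowAt B m))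
  above′ s rewrite atℕ-map val {false} (rowAt B m) s with atℕ false (rowAt B m) s
  ... | true  = inj₂ ≤-refl
  ... | false = inj₁ refl
  below′ : AllAt (_≤ suc m) (Vec.map val (rowAt B m))
  below′ s rewrite atℕ-map val {false} (rowAt B m) s with atℕ false (rowAt B m) s
  ... | true  = ≤-refl
  ... | false = z≤n

Labelled-type : ∀ {m} (B : Vec (Subset n) (suc m)) → Labelled B 0 (type B)
Labelled-type {m = m} B = Labelled-fold m (n≤1+n m) (Labelled-top B)

Level-tail : ∀ {x} {B : Vec (Subset n) L} {r l C} → Level (x ∷ B) (suc r) l C → Level B r l C
Level-tail base       = base
Level-tail (step v p) = step (Level-tail v) p

-- Exchanges from the top downwards bring the departure set C into the bottom row without changing
-- the canonical form. An exchange is valid for every initial queue length, so pairings that wrap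
-- around are covered by starting with the load.
Level-canon : ∀ {m l} {M : Vec (Subset n) (suc m)} {C} → l < suc m → Level M 0 l C →
  ∃ λ N → canon (C ∷ N) ≡ canon M
Level-canon {M = x ∷ N} l<L base = N , refl
Level-canon {m = suc m} {M = x ∷ N} (s≤s l<L) (step {C = C} v p) with Level-canon l<L (Level-tail v)
... | R , e rewrite Pairing.departures p =
  rest q C x ∷ R , trans (canon-exchange q x C R) (cong (insertRow x) e)
  where q = Pairing.load p

queued-mono : ∀ {q q′} {V Y X : Subset n} (x : Subset n) → q ≤ q′ → Late V Y X → queued q V x ≤ queued q′ X x
queued-mono []      p []      = p
queued-mono (b ∷ x) p (v ∷ l) = queued-mono x (queueStep-mono b p v) l

Late-refl : (x : Subset n) → Late x x x
Late-refl []      = []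
Late-refl (b ∷ x) = ⊑-refl ∷ Late-refl x

level-⊑ : ∀ (x : Subset n) (N : Vec (Subset n) L) l → Late (level (x ∷ N) l) (level (x ∷ N) l) x
level-⊑ x N zero    = Late-refl x
level-⊑ x N (suc l) = served-⊑ 0 (level N l) x

-- In a stable array each row serves the whole row above from an empty queue, hence also any subset
-- of it. So no pairing wraps around and every load is zero.
Level-stable : ∀ {l} {N : Vec (Subset n) L} {C} → Stable N → l < L → Level N 0 l C → C ≡ level N l
Level-stable {N = x ∷ N}     s l<L       base       = refl
Level-stable {N = x ∷ h ∷ N} {C} s (s≤s l<L) (step {l = l} v p)
  with Level-stable (tail-stable s) l<L (Level-tail v)
... | refl = Pairing-nowrap p (n≤0⇒n≡0 (subst (queued 0 (level (h ∷ N) l) x ≤_) h-served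
                                          (queued-mono x z≤n (level-⊑ h N l))))
  where
  h-served : queued 0 h x ≡ 0
  h-served = subst₂ (λ a b → queued 0 a b ≡ 0)
               (cong (Vec.head ∘ Vec.tail) (s 0)) (cong Vec.head (s 0)) (queued-upper h x z≤n)

Separates-atLeast : ∀ k (v : Vec ℕ n) {i j} → Separates (atLeast (suc k) v) i j → lookup v i < lookup v j
Separates-atLeast k v {i} {j} (p , q) = ≤-trans (s≤s v≤k) k<v
  where
  k<v : k < lookup v j
  k<v with suc k ≤? lookup v j
  ... | yes l = l
  ... | no ¬l = ⊥-elim (true≢false q (trans (Vec.lookup-map j (suc k ≤ᵇ_) v) (≤ᵇ-false ¬l)))
  v≤k : lookup v i ≤ k
  v≤k with <-≤-connex k (lookup v i)
  ... | inj₁ l = ⊥-elim (true≢false (trans (Vec.lookup-map i (suc k ≤ᵇ_) v) (≤ᵇ-true l)) p)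
  ... | inj₂ l = l

atLeast-Separates : ∀ k (v : Vec ℕ n) {i j} → lookup v i ≤ k → lookup v j ≡ suc k →
  Separates (atLeast (suc k) v) i j
atLeast-Separates k v {i} {j} p q =
  trans (Vec.lookup-map i (suc k ≤ᵇ_) v) (≤ᵇ-false (λ l → <⇒≱ l p)) ,
  trans (Vec.lookup-map j (suc k ≤ᵇ_) v) (≤ᵇ-true (≤-reflexive (sym q)))

canon-type : ∀ {m} (M : Vec (Subset n) (suc m)) → Stable (canon M) → ∀ {i j} → i F.< j →
  lookup (type M) i < lookup (type M) j → lookup (type (canon M)) i < lookup (type (canon M)) j
canon-type {m = m} M stable {i} {j} i<j αᵢ<αⱼ with lookup (type M) j in eq
-- The threshold is αⱼ = k + 1, so the balls labelled above k include j but not i.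
... | suc k with Level-canon k<L (levels (Labelled-type M) k k<L)
  where
  k<L : k < suc m
  k<L = subst (_≤ suc m) eq (AllAt-lookup {P = _≤ suc m} (type M) (below (Labelled-type M)) j)
-- The separating set is now the bottom row of an array with the same canonical form, so it is
-- inserted beneath `canon N`.
...   | N , e with separates-insertRow [] _ (canon N) i<j (atLeast-Separates k (type M) (≤-pred αᵢ<αⱼ) eq)
...     | k′ , k′<L , sep = Separates-atLeast k′ (type (canon M))
  (subst (λ C → Separates C i j) (sym (Level-stable stable k′<L (levels (Labelled-type (canon M)) k′ k′<L)))
    (subst (λ B → Separates (level B k′) i j) e sep))

-- The collapsing map of Defs

fallsBit : Bool → Bool → ℕ → Bool
fallsBit true  false zero    = true
fallsBit true  false (suc k) = false
fallsBit true  true  k       = false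
fallsBit false b     k       = false

leftmost : Subset n → Subset n → Maybe ℕ
leftmost []       []       = nothing
leftmost (a ∷ as) (b ∷ bs) = if fallsBit a b (surplus as bs) then just 0 else Maybe.map suc (leftmost as bs)

falls : Subset n → Subset n → ℕ
falls []       []       = 0
falls (a ∷ as) (b ∷ bs) = (if fallsBit a b (surplus as bs) then 1 else 0) + falls as bs

bracket : ℕ → List ℕ → ℕ × ℕ → List ℕ
bracket j st (r , c) = if r ≡ᵇ suc j then c ∷ st else (if r ≡ᵇ j then drop 1 st else st)

bracketColumn : Bool → Bool → ℕ → List ℕ → List ℕ
bracketColumn true  true  c st = st
bracketColumn true  false c st = c ∷ st
bracketColumn false true  c st = drop 1 st
bracketColumn false false c st = st

unmatched : (ℕ → ℕ) → Subset n → Subset n → List ℕ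
unmatched g []       []       = []
unmatched g (a ∷ as) (b ∷ bs) =
  unmatched (g ∘ suc) as bs ++ (if fallsBit a b (surplus as bs) then [ g 0 ] else [])

-- The columns act on a stack by popping as many entries as their surplus of ")" and then pushing
-- their own unmatched "(".
fold-bracketColumn : ∀ (a b : Subset n) g (h : List ℕ → ℕ → List ℕ) →
  (∀ k st → h st (g k) ≡ bracketColumn (atℕ false a k) (atℕ false b k) (g k) st) →
  ∀ st → foldl h st (applyUpTo g n) ≡ unmatched g a b ++ drop (surplus a b) st
fold-bracketColumn []       []       g h e st = refl
fold-bracketColumn (a ∷ as) (b ∷ bs) g h e st =
  trans (fold-bracketColumn as bs (g ∘ suc) h (λ k → e (suc k)) (h st (g 0)))
    (trans (cong (λ s → unmatched (g ∘ suc) as bs ++ drop (surplus as bs) s) (e 0 st)) (column a b))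
  where
  k = surplus as bs
  U = unmatched (g ∘ suc) as bs
  dropped : ∀ m (st : List ℕ) → drop m (drop 1 st) ≡ drop (suc m) st
  dropped zero    []       = refl
  dropped (suc m) []       = refl
  dropped m       (x ∷ st) = refl
  plain : ∀ V → U ++ V ≡ (U ++ []) ++ V
  plain V = cong (_++ V) (sym (++-identityʳ U))
  column : ∀ a b → U ++ drop k (bracketColumn a b (g 0) st) ≡
    (U ++ (if fallsBit a b k then [ g 0 ] else [])) ++ drop (surplusStep a b k) st
  column true  true  = plain _
  column false true  = trans (cong (U ++_) (dropped k st)) (plain _)
  column false false = plain _
  column true  false with k
  ... | zero  = sym (++-assoc U [ g 0 ] st)
  ... | suc m = plain _

lastElem-∷ʳ : ∀ xs y → lastElem (xs ++ [ y ]) ≡ just y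
lastElem-∷ʳ []            y = refl
lastElem-∷ʳ (x ∷ [])      y = refl
lastElem-∷ʳ (x ∷ x′ ∷ xs) y = lastElem-∷ʳ (x′ ∷ xs) y

-- The stack lists the most recent "(" first, so its last element is the leftmost one.
lastElem-unmatched : ∀ g (a b : Subset n) → lastElem (unmatched g a b) ≡ Maybe.map g (leftmost a b)
lastElem-unmatched g []       []       = refl
lastElem-unmatched g (a ∷ as) (b ∷ bs) with fallsBit a b (surplus as bs)
... | true  = lastElem-∷ʳ (unmatched (g ∘ suc) as bs) (g 0)
... | false rewrite ++-identityʳ (unmatched (g ∘ suc) as bs) =
  trans (lastElem-unmatched (g ∘ suc) as bs) (Maybe.map-∘ (leftmost as bs))

foldl-concatMap : ∀ {A B C : Set} (h : A → B → A) (f : C → List B) st cs →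
  foldl h st (concatMap f cs) ≡ foldl (λ st c → foldl h st (f c)) st cs
foldl-concatMap h f st []       = refl
foldl-concatMap h f st (c ∷ cs) =
  trans (foldl-++ h st (f c) (concatMap f cs)) (foldl-concatMap h f (foldl h st (f c)) cs)

≡ᵇ-false : ∀ {m k} → m ≢ k → (m ≡ᵇ k) ≡ false
≡ᵇ-false {m} {k} = dec-false (m ≟ k)

≡ᵇ-refl : ∀ m → (m ≡ᵇ m) ≡ true
≡ᵇ-refl m = dec-true (m ≟ m) refl

module _ (N : Vec (Subset n) L) (c : ℕ) where

  letters : ℕ → List (ℕ × ℕ)
  letters m = concatMap (λ r → if ball N r c then (r , c) ∷ [] else []) (map suc (downFrom m))

  letters-low : ∀ {j} m st → m < j → foldl (bracket j) st (letters m) ≡ st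
  letters-low zero    st m<j = refl
  letters-low {j} (suc m) st m<j with ball N (suc m) c
  ... | false = letters-low m st (<⇒≤ m<j)
  ... | true
    rewrite ≡ᵇ-false {m} {j} (λ { refl → <-irrefl refl (<⇒≤ m<j) })
          | ≡ᵇ-false {suc m} {j} (λ { refl → <-irrefl refl m<j }) = letters-low m st (<⇒≤ m<j)

letters-pair : ∀ (N : Vec (Subset n) L) c j st →
  foldl (bracket (suc j)) st (letters N c (suc (suc j))) ≡
  bracketColumn (ball N (suc (suc j)) c) (ball N (suc j) c) c st
letters-pair N c j st
  with ball N (suc (suc j)) c | ball N (suc j) c
... | true  | true  rewrite ≡ᵇ-refl j | ≡ᵇ-false {j} {suc j} (λ ()) = letters-low N c j st ≤-refl
... | true  | false rewrite ≡ᵇ-refl j = letters-low N c j (c ∷ st) ≤-refl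
... | false | true  rewrite ≡ᵇ-refl j | ≡ᵇ-false {j} {suc j} (λ ()) = letters-low N c j (drop 1 st) ≤-refl
... | false | false = letters-low N c j st ≤-refl

letters-column : ∀ (N : Vec (Subset n) L) c j m st → suc (suc j) ≤ m →
  foldl (bracket (suc j)) st (letters N c m) ≡
  bracketColumn (ball N (suc (suc j)) c) (ball N (suc j) c) c st
letters-column N c j m st p with m≤n⇒m<n∨m≡n p
... | inj₂ refl = letters-pair N c j st
letters-column N c j (suc m) st p | inj₁ (s≤s q) with ball N (suc m) c
... | false = letters-column N c j m st q
... | true
  rewrite ≡ᵇ-false {m} {suc j} (λ { refl → <-irrefl refl q })
        | ≡ᵇ-false {m} {j} (λ { refl → <-irrefl refl (<⇒≤ q) }) = letters-column N c j m st q

leftmost-cw : ∀ (N : Vec (Subset n) L) j → suc j < L →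
  lastElem (unmatchedOpen (suc j) (cw N)) ≡ leftmost (rowAt N (suc j)) (rowAt N j)
leftmost-cw {n} {L} N j j<L = trans (cong lastElem stack)
  (trans (lastElem-unmatched id a b) (Maybe.map-id (leftmost a b)))
  where
  a = rowAt N (suc j)
  b = rowAt N j
  drop-[] : ∀ k → drop k (List ℕ ∋ []) ≡ []
  drop-[] zero    = refl
  drop-[] (suc k) = refl
  stack : unmatchedOpen (suc j) (cw N) ≡ unmatched id a b
  stack = trans (foldl-concatMap (bracket (suc j)) (λ c → letters N c L) [] (upTo n))
    (trans (fold-bracketColumn a b id (λ st c → foldl (bracket (suc j)) st (letters N c L))
             (λ c st → letters-column N c j L st j<L) [])
      (trans (cong (unmatched id a b ++_) (drop-[] (surplus a b))) (++-identityʳ _)))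

e↓≡ : ∀ j (N : Vec (Subset n) L) → suc j < L →
  e↓ (suc j) N ≡ maybe′ (λ c → setBall (setBall N (suc (suc j)) c false) (suc j) c true) N
                   (leftmost (rowAt N (suc j)) (rowAt N j))
e↓≡ j N j<L with lastElem (unmatchedOpen (suc j) (cw N)) | leftmost-cw N j j<L
... | nothing | e rewrite sym e = refl
... | just c  | e rewrite sym e = refl

fallsBit-true : ∀ a b k → fallsBit a b k ≡ true → a ≡ true × b ≡ false × k ≡ 0
fallsBit-true true false zero refl = refl , refl , refl

fallsBit-false : ∀ a b k → fallsBit a b k ≡ false →
  lowerBit a b k ≡ b × upperBit a b k ≡ a × lowerBit a b (suc k) ≡ b × upperBit a b (suc k) ≡ a ×
  surplusStep a b (suc k) ≡ suc (surplusStep a b k) × fallsBit a b (suc k) ≡ false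
fallsBit-false true  true  k       e = refl , refl , refl , refl , refl , refl
fallsBit-false true  false (suc k) e = refl , refl , refl , refl , refl , refl
fallsBit-false false true  k       e = refl , refl , refl , refl , refl , refl
fallsBit-false false false k       e = refl , refl , refl , refl , refl , refl

leftmost-nothing : ∀ (a b : Subset n) → leftmost a b ≡ nothing →
  lower a b ≡ b × upper a b ≡ a × falls a b ≡ 0
leftmost-nothing []       []       e = refl , refl , refl
leftmost-nothing (a ∷ as) (b ∷ bs) e with fallsBit a b (surplus as bs) in eq
... | false with leftmost as bs | leftmost-nothing as bs
...   | nothing | ih =
  let (l , u , f) = ih refl ; (l′ , u′ , _) = fallsBit-false a b _ eq in
  cong₂ _∷_ l′ l , cong₂ _∷_ u′ u , f

-- Dropping the leftmost falling ball turns its unmatched "(" into an unmatched ")", which raises by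
-- one the surplus seen by the columns to its left. None of these has a falling ball, so by
-- `fallsBit-false` they are unaffected.
leftmost-just : ∀ (a b : Subset n) {c} → leftmost a b ≡ just c →
  let a′ = setℕ a c false ; b′ = setℕ b c true in
  lower a′ b′ ≡ lower a b × upper a′ b′ ≡ upper a b × surplus a′ b′ ≡ suc (surplus a b) ×
  falls a b ≡ suc (falls a′ b′)
leftmost-just []       []       ()
leftmost-just (a ∷ as) (b ∷ bs) e with fallsBit a b (surplus as bs) in eq
leftmost-just (a ∷ as) (b ∷ bs) refl | true with fallsBit-true a b _ eq
... | refl , refl , k≡0 rewrite k≡0 = refl , refl , refl , refl
leftmost-just (a ∷ as) (b ∷ bs) e | false with leftmost as bs | leftmost-just as bs
leftmost-just (a ∷ as) (b ∷ bs) refl | false | just c | ih with ih refl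
... | l , u , s , f rewrite s =
  let (l₁ , u₁ , l₂ , u₂ , s₂ , f₂) = fallsBit-false a b _ eq in
  cong₂ _∷_ (trans l₂ (sym l₁)) l , cong₂ _∷_ (trans u₂ (sym u₁)) u , s₂ ,
  trans f (cong (λ z → suc ((if z then 1 else 0) + falls (setℕ as c false) (setℕ bs c true))) (sym f₂))

dropBall : ℕ → ℕ → Vec (Subset n) L → Vec (Subset n) L
dropBall j c N = setBall (setBall N (suc (suc j)) c false) (suc j) c true

collapse-dropBall : ∀ j {c} (N : Vec (Subset n) L) → suc j < L →
  leftmost (rowAt N (suc j)) (rowAt N j) ≡ just c →
  let N′ = dropBall j c N in
  collapse j N′ ≡ collapse j N ×
  falls (rowAt N (suc j)) (rowAt N j) ≡ suc (falls (rowAt N′ (suc j)) (rowAt N′ j))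
collapse-dropBall zero    (b ∷ a ∷ N) j<L e =
  let (l , u , _ , f) = leftmost-just a b e in cong₂ (λ x y → x ∷ y ∷ N) l u , f
collapse-dropBall zero    (b ∷ [])    (s≤s ()) e
collapse-dropBall (suc j) (b ∷ N)     (s≤s j<L) e =
  let (p , f) = collapse-dropBall j N j<L e in cong (b ∷_) p , f

collapse-settled : ∀ j (N : Vec (Subset n) L) → suc j < L →
  leftmost (rowAt N (suc j)) (rowAt N j) ≡ nothing → collapse j N ≡ N
collapse-settled zero    (b ∷ a ∷ N) j<L e =
  let (l , u , _) = leftmost-nothing a b e in cong₂ (λ x y → x ∷ y ∷ N) l u
collapse-settled zero    (b ∷ [])    (s≤s ()) e
collapse-settled (suc j) (b ∷ N)     (s≤s j<L) e = cong (b ∷_) (collapse-settled j N j<L e)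

-- Each effective application lowers the number of balls still to fall by one and keeps the
-- collapse; with none left the rows are settled. By `falls-≤` the value k = n suffices.
iterate-e↓ : ∀ k j (N : Vec (Subset n) L) → suc j < L →
  falls (rowAt N (suc j)) (rowAt N j) ≤ k → iterateN k (e↓ (suc j)) N ≡ collapse j N
iterate-e↓ zero j N j<L f≤k with leftmost (rowAt N (suc j)) (rowAt N j) in eq
... | nothing = sym (collapse-settled j N j<L eq)
... | just c  = contradiction (subst (_≤ 0) (proj₂ (collapse-dropBall j N j<L eq)) f≤k) λ ()
iterate-e↓ (suc k) j N j<L f≤k rewrite e↓≡ j N j<L with leftmost (rowAt N (suc j)) (rowAt N j) in eq
... | nothing = iterate-e↓ k j N j<L
  (subst (_≤ k) (sym (proj₂ (proj₂ (leftmost-nothing (rowAt N (suc j)) (rowAt N j) eq)))) z≤n)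
... | just c  =
  let (p , f) = collapse-dropBall j N j<L eq in
  trans (iterate-e↓ k j (dropBall j c N) j<L (≤-pred (subst (_≤ suc k) f f≤k))) p

falls-≤ : (a b : Subset n) → falls a b ≤ n
falls-≤ []       []       = z≤n
falls-≤ (a ∷ as) (b ∷ bs) with fallsBit a b (surplus as bs)
... | true  = s≤s (falls-≤ as bs)
... | false = ≤-trans (falls-≤ as bs) (n≤1+n _)

e↓⋆≡collapse : ∀ j (N : Vec (Subset n) L) → suc j < L → e↓⋆ (suc j) N ≡ collapse j N
e↓⋆≡collapse {n} j N j<L = iterate-e↓ n j N j<L (falls-≤ (rowAt N (suc j)) (rowAt N j))

e↓⋆range≡sweep : ∀ b (N : Vec (Subset n) L) → b < L → e↓⋆range b N ≡ sweep b N
e↓⋆range≡sweep zero    N b<L = refl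
e↓⋆range≡sweep (suc b) N b<L =
  trans (cong (e↓⋆range b) (e↓⋆≡collapse b N b<L)) (e↓⋆range≡sweep b (collapse b N) (<⇒≤ b<L))

fold≡sweeps : ∀ m (N : Vec (Subset n) L) → m < L →
  foldl (λ N b → e↓⋆range b N) N (map suc (upTo m)) ≡ sweeps m N
fold≡sweeps zero    N m<L = refl
fold≡sweeps (suc m) N m<L =
  trans (cong (foldl f N) (trans (cong (map suc) (sym (upTo-∷ʳ m))) (map-++ suc (upTo m) [ m ])))
    (trans (foldl-++ f N (map suc (upTo m)) [ suc m ])
      (trans (cong (e↓⋆range (suc m)) (fold≡sweeps m N (<⇒≤ m<L)))
             (e↓⋆range≡sweep (suc m) (sweeps m N) m<L)))
  where f = λ N b → e↓⋆range b N

ρN≡canon : ∀ {m} (M : Vec (Subset n) (suc m)) → ρN M ≡ canon M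
ρN≡canon {m = m} M = trans (fold≡sweeps m M ≤-refl) (sweeps≡canon M)

theorem3p26 : ∀ (n L : ℕ) (M : Vec (Subset n) L) → IsMLQ M →
    ∀ (i j : Fin n) → i F.< j →
    lookup (type M) i < lookup (type M) j →
    lookup (type (ρN M)) i < lookup (type (ρN M)) j
-- With no rows every label is 0, so no two labels compare strictly.
theorem3p26 n zero    [] _ i j _ αᵢ<αⱼ =
  contradiction (subst (lookup (replicate n 0) i <_) (Vec.lookup-replicate j 0) αᵢ<αⱼ) λ ()
theorem3p26 n (suc m) M  _ i j i<j αᵢ<αⱼ rewrite ρN≡canon M =
  canon-type M (subst Stable (sweeps≡canon M) (sweeps-stable M)) i<j αᵢ<αⱼ
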